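{- There exists a constant $c>0$ such that for all sufficiently large $n$, $$r_n\geq n^{c\frac{\log n}{\log\log n}},$$ i.e. $r_n\geq n^{\Omega\left(\frac{\log n}{\log\log n}\right)}$.
   Context: Let $\Omega_n$ denote the set of all $n\times n$ real matrices all of whose entries are $\pm1$, and for an $n\times n$ matrix $A$ let $\mathrm{per}(A)=\sum_{\sigma\in S_n}\prod_{i=1}^n A_{i\sigma(i)}$ be its permanent. Let $r_n=|\{\mathrm{per}(A):A\in\Omega_n\}|$ be the number of distinct values attained by the permanent on $\Omega_n$. -}

module Defs where

open import Data.Nat using (ℕ; zero; suc)
open import Data.Integer using (ℤ; +_; -_; _+_; _*_) renaming (_≟_ to _≟ℤ_)
open import Data.Fin using (Fin)
open import Data.Fin.Properties using () renaming (_≟_ to _≟F_)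
open import Data.List using (List; []; _∷_; [_]; map; concatMap; filter; length; deduplicate; foldr)
import Data.List.Relation.Unary.Unique.DecPropositional as UniqueDec
open import Data.Vec using (Vec; lookup; toList; allFin) renaming ([] to []ᵥ; _∷_ to _∷ᵥ_)

allVecs : {A : Set} → List A → (n : ℕ) → List (Vec A n)
allVecs xs zero = [ []ᵥ ]
allVecs xs (suc n) = concatMap (λ x → map (x ∷ᵥ_) (allVecs xs n)) xs

-- S_n: a permutation σ of Fin n is represented by the vector (σ 0, …, σ (n-1)),
-- i.e. a vector of length n over Fin n with pairwise distinct entries.
permutations : (n : ℕ) → List (Vec (Fin n) n)
permutations n = filter (λ v → UniqueDec.unique? (_≟F_ {n}) (toList v)) (allVecs (toList (allFin n)) n)

Matrix : ℕ → Set
Matrix n = Vec (Vec ℤ n) n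

sumℤ : List ℤ → ℤ
sumℤ = foldr _+_ (+ 0)

prodℤ : List ℤ → ℤ
prodℤ = foldr _*_ (+ 1)

per : {n : ℕ} → Matrix n → ℤ
per {n} A = sumℤ (map (λ σ → prodℤ (map (λ i → lookup (lookup A i) (lookup σ i)) (toList (allFin n))))
                      (permutations n))

Ω : (n : ℕ) → List (Matrix n)
Ω n = allVecs (allVecs (+ 1 ∷ - (+ 1) ∷ []) n) n

r : ℕ → ℕ
r n = length (deduplicate _≟ℤ_ (map per (Ω n)))

{-# OPTIONS --safe #-}

-- Let A_k = ℤ[y₁,…,y_k]/(yᵢ²).  If all rows of a matrix but the first k are constant 1, its
-- permanent is q! times the coefficient of y₁⋯y_k in the product over the columns c of
-- 1 + Σ cᵢ yᵢ, where q is the number of constant rows.  Over the cube {±1}ᵏ this product is 1.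
-- Take N columns of ones and copies of the cube, and one more row that is 1 on the columns of
-- ones and ± the character χ_s(c) = c₁⋯c_s on each copy, where s may vary.  Logarithmic
-- differentiation turns a copy into Σ_c χ_s(c) / (1 + Σ cᵢ yᵢ) = ± 2ᵏ s! y₁⋯y_s, so it adds
-- ± 2ᵏ s! N(N-1)⋯(N-k+s+1) to the coefficient.  These weights decrease by a factor > m from
-- each s to the next, so m copies for each s < k act as the digits of a number in base m + 1
-- and give (m+1)ᵏ distinct permanents; take k about (log n)/4 and m + 1 = 2ᵏ.

module Submission where

open import Defs
open import Algebra using (CommutativeSemiring)
import Algebra.Properties.AbelianGroup
import Algebra.Properties.Semiring.Exp as Exp
import Algebra.Solver.Ring.NaturalCoefficients.Default as SemiringSolver
open import Algebra.Structures.Biased using (isCommutativeSemiringˡ)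
open import Data.Bool using (true; false; if_then_else_)
open import Data.Fin as Fin using (Fin; toℕ)
import Data.Fin.Properties as Finₚ
open import Data.Integer as ℤ using (ℤ; 1ℤ; -1ℤ)
import Data.Integer.Properties as ℤₚ
open import Data.Integer.Tactic.RingSolver using (solve-∀)
open import Data.List as List using (List; []; _∷_; foldr; map; _++_; concatMap; filter; length; deduplicate)
import Data.List.Properties as Listₚ
open import Data.List.Membership.Propositional using (_∈_)
import Data.List.Membership.Propositional.Properties as ∈ₚ
open import Data.List.Relation.Unary.All as All using (All; []; _∷_)
import Data.List.Relation.Unary.All.Properties as Allₚ
open import Data.List.Relation.Unary.AllPairs using ([]; _∷_)
open import Data.List.Relation.Unary.Any as Any using (here; there)
import Data.List.Relation.Unary.Any.Properties as Anyₚ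
import Data.List.Relation.Unary.Unique.DecPropositional as UniqueDec
open import Data.List.Relation.Unary.Unique.Propositional using (Unique)
import Data.List.Relation.Unary.Unique.Propositional.Properties as Uniqueₚ
open import Data.Nat as ℕ using (ℕ; zero; suc; _!; _≤_; _<_; z≤n; s≤s)
open import Data.Nat.DivMod using (m/n*n≤m; m≡m%n+[m/n]*n; m%n<n)
open import Data.Nat.Induction using (<-rec)
open import Data.Nat.Logarithm using (⌊log₂_⌋; ⌊log₂⌋-mono-≤; ⌊log₂⌊n/2⌋⌋≡⌊log₂n⌋∸1; ⌊log₂[2^n]⌋≡n)
import Data.Nat.Properties as ℕₚ
open import Data.Product using (Σ; ∃; _×_; _,_; proj₁; proj₂; map₂)
open import Data.Product.Relation.Binary.Pointwise.NonDependent using (Pointwise; ×-isEquivalence)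
open import Data.Vec as Vec using (Vec; []; _∷_; head; tail; replicate; lookup; toList; fromList)
import Data.Vec.Properties as Vecₚ
import Data.Vec.Relation.Unary.All as VAll
import Data.Vec.Relation.Unary.All.Properties as VAllₚ
open import Function using (_∘_; id)
open import Level using (0ℓ)
open import Relation.Binary.PropositionalEquality as ≡ using (_≡_; _≢_)
open import Relation.Nullary using (does; ¬?)
open import Relation.Unary using (Decidable)

module ℤ-Group = Algebra.Properties.AbelianGroup ℤₚ.+-0-abelianGroup

-- Finite sums and products in a commutative semiring.

Semiring₀ : Set₁
Semiring₀ = CommutativeSemiring 0ℓ 0ℓ

picks : {X : Set} → List X → List (X × List X)
picks []       = []
picks (x ∷ xs) = (x , xs) ∷ map (map₂ (x ∷_)) (picks xs)

module FiniteSums (R : Semiring₀) where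
  open CommutativeSemiring R
  open SemiringSolver R using (solve; _:=_; _:+_)

  sum prod : {X : Set} → (X → Carrier) → List X → Carrier
  sum  f = foldr (λ x → f x +_) 0#
  prod f = foldr (λ x → f x *_) 1#

  module _ {X : Set} where

    sum-cong-local : {f g : X → Carrier} → ∀ {xs} → All (λ x → f x ≈ g x) xs → sum f xs ≈ sum g xs
    sum-cong-local []            = refl
    sum-cong-local (f≈g ∷ fs≈gs) = +-cong f≈g (sum-cong-local fs≈gs)

    sum-cong : {f g : X → Carrier} → (∀ x → f x ≈ g x) → ∀ xs → sum f xs ≈ sum g xs
    sum-cong f≈g []       = refl
    sum-cong f≈g (x ∷ xs) = +-cong (f≈g x) (sum-cong f≈g xs)

    sum-++ : (f : X → Carrier) → ∀ xs ys → sum f (xs ++ ys) ≈ sum f xs + sum f ys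
    sum-++ f []       ys = sym (+-identityˡ _)
    sum-++ f (x ∷ xs) ys = trans (+-congˡ (sum-++ f xs ys)) (sym (+-assoc _ _ _))

    sum-+ : (f g : X → Carrier) → ∀ xs → sum (λ x → f x + g x) xs ≈ sum f xs + sum g xs
    sum-+ f g []       = sym (+-identityˡ _)
    sum-+ f g (x ∷ xs) = trans (+-congˡ (sum-+ f g xs))
      (solve 4 (λ a b c d → (a :+ b) :+ (c :+ d) := (a :+ c) :+ (b :+ d)) refl _ _ _ _)

    sum-*ˡ : ∀ c (f : X → Carrier) xs → sum (λ x → c * f x) xs ≈ c * sum f xs
    sum-*ˡ c f []       = sym (zeroʳ c)
    sum-*ˡ c f (x ∷ xs) = trans (+-congˡ (sum-*ˡ c f xs)) (sym (distribˡ c _ _))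

    prod-cong : {f g : X → Carrier} → (∀ x → f x ≈ g x) → ∀ xs → prod f xs ≈ prod g xs
    prod-cong f≈g []       = refl
    prod-cong f≈g (x ∷ xs) = *-cong (f≈g x) (prod-cong f≈g xs)

    prod-++ : (f : X → Carrier) → ∀ xs ys → prod f (xs ++ ys) ≈ prod f xs * prod f ys
    prod-++ f []       ys = sym (*-identityˡ _)
    prod-++ f (x ∷ xs) ys = trans (*-congˡ (prod-++ f xs ys)) (sym (*-assoc _ _ _))

  module _ {X Y : Set} (h : Y → X) where

    sum-map : (f : X → Carrier) → ∀ ys → sum f (map h ys) ≡ sum (f ∘ h) ys
    sum-map f []       = ≡.refl
    sum-map f (y ∷ ys) = ≡.cong (f (h y) +_) (sum-map f ys)

    prod-map : (f : X → Carrier) → ∀ ys → prod f (map h ys) ≡ prod (f ∘ h) ys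
    prod-map f []       = ≡.refl
    prod-map f (y ∷ ys) = ≡.cong (f (h y) *_) (prod-map f ys)

-- Dual numbers and the product rule.

-- R[y]/(y²), the pair (a , b) standing for a + b y.
module Dual (R : Semiring₀) where
  open CommutativeSemiring R
  open import Relation.Binary.Reasoning.Setoid setoid
  open SemiringSolver R using (solve; _:=_; _:+_; _:*_; con)

  dual : Semiring₀
  dual = record
    { Carrier = Carrier × Carrier
    ; _≈_ = Pointwise _≈_ _≈_
    ; _+_ = λ (a , b) (c , d) → a + c , b + d
    ; _*_ = λ (a , b) (c , d) → a * c , a * d + b * c
    ; 0# = 0# , 0#
    ; 1# = 1# , 0#
    ; isCommutativeSemiring = isCommutativeSemiringˡ record
      { +-isCommutativeMonoid = record
        { isMonoid = record
          { isSemigroup = record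
            { isMagma = record
              { isEquivalence = equiv
              ; ∙-cong = λ (p , q) (p′ , q′) → +-cong p p′ , +-cong q q′ }
            ; assoc = λ _ _ _ → +-assoc _ _ _ , +-assoc _ _ _ }
          ; identity = (λ _ → +-identityˡ _ , +-identityˡ _)
                     , (λ _ → +-identityʳ _ , +-identityʳ _) }
        ; comm = λ _ _ → +-comm _ _ , +-comm _ _ }
      ; *-isCommutativeMonoid = record
        { isMonoid = record
          { isSemigroup = record
            { isMagma = record
              { isEquivalence = equiv
              ; ∙-cong = λ (p , q) (p′ , q′) →
                  *-cong p p′ , +-cong (*-cong p q′) (*-cong q p′) }
            ; assoc = λ (a , b) (c , d) (e , f) → *-assoc _ _ _ ,
                solve 6 (λ a b c d e f → (a :* c) :* f :+ (a :* d :+ b :* c) :* e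
                                      := a :* (c :* f :+ d :* e) :+ b :* (c :* e))
                  refl a b c d e f }
          ; identity = (λ (a , b) → *-identityˡ a ,
                solve 2 (λ a b → con 1 :* b :+ con 0 :* a := b) refl a b)
                     , (λ (a , b) → *-identityʳ a ,
                solve 2 (λ a b → a :* con 0 :+ b :* con 1 := b) refl a b) }
        ; comm = λ (a , b) (c , d) → *-comm a c ,
            solve 4 (λ a b c d → a :* d :+ b :* c := c :* b :+ d :* a) refl a b c d }
      ; distribʳ = λ (a , b) (c , d) (e , f) → distribʳ a c e ,
          solve 6 (λ a b c d e f → (c :+ e) :* b :+ (d :+ f) :* a
                                := (c :* b :+ d :* a) :+ (e :* b :+ f :* a))
            refl a b c d e f
      ; zeroˡ = λ (a , b) → zeroˡ a ,
          solve 2 (λ a b → con 0 :* b :+ con 0 :* a := con 0) refl a b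
      }
    }
    where equiv = ×-isEquivalence isEquivalence isEquivalence

  open FiniteSums R
  private module D = FiniteSums dual

  module _ {X : Set} (a b : X → Carrier) where

    sum-dual : ∀ xs → D.sum (λ x → a x , b x) xs ≡ (sum a xs , sum b xs)
    sum-dual []       = ≡.refl
    sum-dual (x ∷ xs) = ≡.cong (CommutativeSemiring._+_ dual (a x , b x)) (sum-dual xs)

    prod-proj₁ : ∀ xs → proj₁ (D.prod (λ x → a x , b x) xs) ≡ prod a xs
    prod-proj₁ []       = ≡.refl
    prod-proj₁ (x ∷ xs) = ≡.cong (a x *_) (prod-proj₁ xs)

    -- This is the product rule: one factor is differentiated and the others keep their constant
    -- part. The sum over `picks` has the shape of a Laplace expansion along a row, and
    -- `expansion-top` relies on this.
    prod-leibniz : ∀ xs → proj₂ (D.prod (λ x → a x , b x) xs)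
                        ≈ sum (λ (x , xs′) → b x * prod a xs′) (picks xs)
    prod-leibniz []       = refl
    prod-leibniz (x ∷ xs) = begin
      a x * proj₂ (D.prod ab xs) + b x * proj₁ (D.prod ab xs)
        ≈⟨ +-cong (*-congˡ (prod-leibniz xs)) (*-congˡ (reflexive (prod-proj₁ xs))) ⟩
      a x * sum F (picks xs) + b x * prod a xs
        ≈⟨ +-congʳ (sym (sum-*ˡ (a x) F (picks xs))) ⟩
      sum (λ p → a x * F p) (picks xs) + b x * prod a xs
        ≈⟨ +-comm _ _ ⟩
      b x * prod a xs + sum (λ p → a x * F p) (picks xs)
        ≈⟨ +-congˡ (sum-cong (λ _ → solve 3 (λ u v w → u :* (v :* w) := v :* (u :* w)) refl _ _ _) (picks xs)) ⟩
      b x * prod a xs + sum (F ∘ map₂ (x ∷_)) (picks xs)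
        ≡⟨ ≡.cong (b x * prod a xs +_) (≡.sym (sum-map (map₂ (x ∷_)) F (picks xs))) ⟩
      b x * prod a xs + sum F (map (map₂ (x ∷_)) (picks xs)) ∎
      where
      ab : X → Carrier × Carrier
      ab x = a x , b x
      F : X × List X → Carrier
      F (x , xs′) = b x * prod a xs′

    module _ (a⁻¹ : X → Carrier) (inverse : ∀ x → a x * a⁻¹ x ≈ 1#) where

      -- Logarithmic differentiation: with invertible factors, the sum of the product rule turns
      -- into a plain sum over xs times the whole product, and over the cube such a sum can be
      -- paired off.
      prod-logarithmic : ∀ xs → proj₂ (D.prod (λ x → a x , b x) xs)
                              ≈ prod a xs * sum (λ x → b x * a⁻¹ x) xs
      prod-logarithmic []       = sym (zeroʳ 1#)
      prod-logarithmic (x ∷ xs) = begin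
        a x * proj₂ (D.prod ab xs) + b x * proj₁ (D.prod ab xs)
          ≈⟨ +-cong (*-congˡ (prod-logarithmic xs)) (*-congˡ (reflexive (prod-proj₁ xs))) ⟩
        a x * (P * S) + b x * P
          ≈⟨ +-congˡ (sym (*-identityʳ _)) ⟩
        a x * (P * S) + b x * P * 1#
          ≈⟨ +-congˡ (*-congˡ (sym (inverse x))) ⟩
        a x * (P * S) + b x * P * (a x * a⁻¹ x)
          ≈⟨ solve 5 (λ a b c p s → a :* (p :* s) :+ b :* p :* (a :* c)
                                 := a :* p :* (b :* c :+ s)) refl _ _ _ _ _ ⟩
        a x * P * (b x * a⁻¹ x + S) ∎
        where
        ab : X → Carrier × Carrier
        ab x = a x , b x
        P S : Carrier
        P = prod a xs
        S = sum (λ x → b x * a⁻¹ x) xs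

  open Exp semiring using (_^_)
  open Exp (CommutativeSemiring.semiring dual) using () renaming (_^_ to _^ᴰ_)

  ^-proj₁ : ∀ x n → proj₁ (x ^ᴰ n) ≡ proj₁ x ^ n
  ^-proj₁ x zero    = ≡.refl
  ^-proj₁ x (suc n) = ≡.cong (proj₁ x *_) (^-proj₁ x n)

-- The algebra with square-zero generators and its linear elements.

-- ℤ[y₁,…,y_k]/(y₁²,…,y_k²)
Alg : ℕ → Semiring₀
Alg zero    = ℤₚ.+-*-commutativeSemiring
Alg (suc k) = Dual.dual (Alg k)

∣Alg∣ : ℕ → Set
∣Alg∣ k = CommutativeSemiring.Carrier (Alg k)

scalar : ∀ k → ℤ → ∣Alg∣ k
scalar zero    c = c
scalar (suc k) c = scalar k c , CommutativeSemiring.0# (Alg k)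

scalar-+ : ∀ k c d → let open CommutativeSemiring (Alg k) in
           scalar k (c ℤ.+ d) ≈ scalar k c + scalar k d
scalar-+ zero    c d = ≡.refl
scalar-+ (suc k) c d = scalar-+ k c d , CommutativeSemiring.sym (Alg k) (CommutativeSemiring.+-identityˡ (Alg k) _)

scalar-* : ∀ k c d → let open CommutativeSemiring (Alg k) in
           scalar k (c ℤ.* d) ≈ scalar k c * scalar k d
scalar-* zero    c d = ≡.refl
scalar-* (suc k) c d = scalar-* k c d , sym (trans (+-cong (zeroʳ _) (zeroˡ _)) (+-identityˡ 0#))
  where open CommutativeSemiring (Alg k) hiding (zero)

scalar-0 : ∀ k → let open CommutativeSemiring (Alg k) in scalar k ℤ.0ℤ ≈ 0#
scalar-0 zero    = ≡.refl
scalar-0 (suc k) = scalar-0 k , CommutativeSemiring.refl (Alg k)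

scalar-1 : ∀ k → let open CommutativeSemiring (Alg k) in scalar k 1ℤ ≈ 1#
scalar-1 zero    = ≡.refl
scalar-1 (suc k) = scalar-1 k , CommutativeSemiring.refl (Alg k)

module _ (k : ℕ) where
  open CommutativeSemiring (Alg k) hiding (zero)

  scalar-inverse : ∀ c → scalar k (ℤ.- c) + scalar k c ≈ 0#
  scalar-inverse c = trans (sym (scalar-+ k _ c))
    (trans (reflexive (≡.cong (scalar k) (ℤₚ.+-inverseˡ c))) (scalar-0 k))

  scalar-suc : ∀ n → scalar k (ℤ.+ suc n) ≈ 1# + scalar k (ℤ.+ n)
  scalar-suc n = trans (scalar-+ k 1ℤ (ℤ.+ n)) (+-congʳ (scalar-1 k))

-- the coefficient of y₁⋯y_k
top : ∀ k → ∣Alg∣ k → ℤ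
top zero    x = x
top (suc k) x = top k (proj₂ x)

top-cong : ∀ k {x y} → CommutativeSemiring._≈_ (Alg k) x y → top k x ≡ top k y
top-cong zero    x≡y = x≡y
top-cong (suc k) x≈y = top-cong k (proj₂ x≈y)

top-+ : ∀ k x y → let open CommutativeSemiring (Alg k) in top k (x + y) ≡ top k x ℤ.+ top k y
top-+ zero    x y = ≡.refl
top-+ (suc k) x y = top-+ k (proj₂ x) (proj₂ y)

top-0 : ∀ k → top k (CommutativeSemiring.0# (Alg k)) ≡ ℤ.0ℤ
top-0 zero    = ≡.refl
top-0 (suc k) = top-0 k

top-scalar : ∀ k c x → let open CommutativeSemiring (Alg k) in top k (scalar k c * x) ≡ c ℤ.* top k x
top-scalar zero    c x = ≡.refl
top-scalar (suc k) c x = ≡.trans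
  (top-cong k (trans (+-congˡ (zeroˡ _)) (+-identityʳ _)))
  (top-scalar k c (proj₂ x))
  where open CommutativeSemiring (Alg k) hiding (zero)

-- 1 + c₁y₁ + ⋯ + c_k y_k
linear : ∀ k → Vec ℤ k → ∣Alg∣ k
linear zero    c = 1ℤ
linear (suc k) c = linear k (tail c) , scalar k (head c)

-- Since y² = 0, the inverse of a + b y is a⁻¹ - b a⁻² y.
linear⁻¹ : ∀ k → Vec ℤ k → ∣Alg∣ k
linear⁻¹ zero    c = 1ℤ
linear⁻¹ (suc k) c = linear⁻¹ k (tail c) , scalar k (ℤ.- head c) * (linear⁻¹ k (tail c) * linear⁻¹ k (tail c))
  where open CommutativeSemiring (Alg k) hiding (zero)

linear-inverse : ∀ k c → let open CommutativeSemiring (Alg k) in linear k c * linear⁻¹ k c ≈ 1#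
linear-inverse zero    c = ≡.refl
linear-inverse (suc k) c = linear-inverse k (tail c) , (begin
  a * (n * (i * i)) + b * i      ≈⟨ solve 4 (λ a n i b → a :* (n :* (i :* i)) :+ b :* i
                                                   := n :* ((a :* i) :* i) :+ b :* i) refl a n i b ⟩
  n * ((a * i) * i) + b * i      ≈⟨ +-congʳ (*-congˡ (*-congʳ (linear-inverse k (tail c)))) ⟩
  n * (1# * i) + b * i           ≈⟨ solve 3 (λ n i b → n :* (con 1 :* i) :+ b :* i := (n :+ b) :* i) refl n i b ⟩
  (n + b) * i                    ≈⟨ *-congʳ (scalar-inverse k (head c)) ⟩
  0# * i                         ≈⟨ zeroˡ i ⟩
  0#                             ∎)
  where
  open CommutativeSemiring (Alg k) hiding (zero)
  open import Relation.Binary.Reasoning.Setoid setoid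
  open SemiringSolver (Alg k) using (solve; _:=_; _:+_; _:*_; con)
  a = linear k (tail c)
  i = linear⁻¹ k (tail c)
  n = scalar k (ℤ.- head c)
  b = scalar k (head c)

-- Products and character sums over the cube.

cube : ∀ k → List (Vec ℤ k)
cube zero    = [] ∷ []
cube (suc k) = map (1ℤ ∷_) (cube k) ++ map (-1ℤ ∷_) (cube k)

module _ (R : Semiring₀) (k : ℕ) where
  open CommutativeSemiring R
  open FiniteSums R

  sum-cube : (f : Vec ℤ (suc k) → Carrier) →
             sum f (cube (suc k)) ≈ sum (λ c → f (1ℤ ∷ c) + f (-1ℤ ∷ c)) (cube k)
  sum-cube f = trans (sum-++ f (map (1ℤ ∷_) (cube k)) (map (-1ℤ ∷_) (cube k)))
    (trans (+-cong (reflexive (sum-map (1ℤ ∷_) f (cube k))) (reflexive (sum-map (-1ℤ ∷_) f (cube k))))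
           (sym (sum-+ (f ∘ (1ℤ ∷_)) (f ∘ (-1ℤ ∷_)) (cube k))))

  sum-cube-0 : (f : Vec ℤ (suc k) → Carrier) → (∀ c → f (1ℤ ∷ c) + f (-1ℤ ∷ c) ≈ 0#) →
               sum f (cube (suc k)) ≈ 0#
  sum-cube-0 f f0 = trans (sum-cube f) (trans (sum-cong (λ c → trans (f0 c) (sym (zeroˡ 0#))) (cube k))
    (trans (sum-*ˡ 0# (λ _ → 0#) (cube k)) (zeroˡ _)))

-- Modulo y₁ every vector of the smaller cube occurs twice, which gives 1 · 1. The y₁-part is a
-- logarithmic derivative whose terms are odd in the first sign, so they cancel in pairs.
prod-cube : ∀ k → let open CommutativeSemiring (Alg k) in FiniteSums.prod (Alg k) (linear k) (cube k) ≈ 1#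
prod-cube zero    = ≡.refl
prod-cube (suc k) = first , second
  where
  open CommutativeSemiring (Alg k) hiding (zero)
  open import Relation.Binary.Reasoning.Setoid setoid
  open FiniteSums (Alg k)
  module D = FiniteSums (Alg (suc k))
  first : proj₁ (D.prod (linear (suc k)) (cube (suc k))) ≈ 1#
  first = begin
    proj₁ (D.prod (linear (suc k)) (cube (suc k)))
      ≡⟨ Dual.prod-proj₁ (Alg k) (linear k ∘ tail) (scalar k ∘ head) (cube (suc k)) ⟩
    prod (linear k ∘ tail) (cube (suc k))
      ≈⟨ prod-++ (linear k ∘ tail) (map (1ℤ ∷_) (cube k)) (map (-1ℤ ∷_) (cube k)) ⟩
    prod (linear k ∘ tail) (map (1ℤ ∷_) (cube k)) * prod (linear k ∘ tail) (map (-1ℤ ∷_) (cube k))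
      ≡⟨ ≡.cong₂ _*_ (prod-map (1ℤ ∷_) (linear k ∘ tail) (cube k)) (prod-map (-1ℤ ∷_) (linear k ∘ tail) (cube k)) ⟩
    prod (linear k) (cube k) * prod (linear k) (cube k)
      ≈⟨ *-cong (prod-cube k) (prod-cube k) ⟩
    1# * 1#
      ≈⟨ *-identityˡ 1# ⟩
    1# ∎
  second : proj₂ (D.prod (linear (suc k)) (cube (suc k))) ≈ 0#
  second = trans
    (Dual.prod-logarithmic (Alg k) (linear k ∘ tail) (scalar k ∘ head) (linear⁻¹ k ∘ tail)
      (linear-inverse k ∘ tail) (cube (suc k)))
    (trans (*-congˡ (sum-cube-0 (Alg k) k (λ c → scalar k (head c) * linear⁻¹ k (tail c))
      (λ c → trans (sym (distribʳ _ _ _)) (trans (*-congʳ (trans (+-comm _ _) (scalar-inverse k 1ℤ))) (zeroˡ _)))))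
      (zeroʳ _))

χ : ∀ {k} → ℕ → Vec ℤ k → ℤ
χ zero    _       = 1ℤ
-- The value for s > k agrees with the defaults of `monomial` and `weight` at k = 0, so that the
-- identities about them hold for all s.
χ (suc s) []      = 1ℤ
χ (suc s) (ε ∷ c) = ℤ.- ε ℤ.* χ s c

-- 2ᵏ p(p+1)⋯(p+s-1) y₁⋯y_s for s ≤ k; the minus sign in χ makes it positive
monomial : ∀ k → ℕ → ℕ → ∣Alg∣ k
monomial zero    s       p = 1ℤ
monomial (suc k) zero    p = scalar k (ℤ.+ 2) * monomial k zero p , 0#
  where open CommutativeSemiring (Alg k) hiding (zero)
monomial (suc k) (suc s) p = 0# , scalar k (ℤ.+ (2 ℕ.* p)) * monomial k s (suc p)
  where open CommutativeSemiring (Alg k) hiding (zero)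

module _ (k : ℕ) where
  open CommutativeSemiring (Alg k) hiding (zero)
  open import Relation.Binary.Reasoning.Setoid setoid
  open Exp semiring using (_^_)
  open Exp (CommutativeSemiring.semiring (Alg (suc k))) using () renaming (_^_ to _^ᴰ_)
  open SemiringSolver (Alg k) using (solve; _:=_; _:+_; _:*_; con)

  -- The power rule p a^(p-1) · β a². Differentiating a power of an inverse raises the exponent,
  -- which is the source of the rising factorial in `monomial`.
  inverse-power : ∀ a β p → let x = (a , β * (a * a)) in
    proj₂ (x ^ᴰ p) ≈ scalar k (ℤ.+ p) * (β * a ^ suc p)
  inverse-power a β zero    = sym (trans (*-congʳ (scalar-0 k)) (zeroˡ _))
  inverse-power a β (suc p) = begin
    a * proj₂ (x ^ᴰ p) + β * (a * a) * proj₁ (x ^ᴰ p)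
      ≈⟨ +-cong (*-congˡ (inverse-power a β p)) (*-congˡ (reflexive (Dual.^-proj₁ (Alg k) x p))) ⟩
    a * (n * (β * (a * a ^ p))) + β * (a * a) * a ^ p
      ≈⟨ solve 4 (λ a n β z → a :* (n :* (β :* (a :* z))) :+ β :* (a :* a) :* z
                           := (con 1 :+ n) :* (β :* (a :* (a :* z)))) refl a n β (a ^ p) ⟩
    (1# + n) * (β * (a * (a * a ^ p)))
      ≈⟨ *-congʳ (sym (scalar-suc k p)) ⟩
    scalar k (ℤ.+ suc p) * (β * (a * (a * a ^ p))) ∎
    where
    x = (a , β * (a * a))
    n = scalar k (ℤ.+ p)

  -- Here the exponent drops instead, which is the source of the falling factorial in `weight`.
  linear-power : ∀ a p → proj₂ ((a , 1#) ^ᴰ suc p) ≈ scalar k (ℤ.+ suc p) * a ^ p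
  linear-power a zero    = trans (+-congʳ (zeroʳ a)) (trans (+-identityˡ _) (*-congʳ (sym (scalar-1 k))))
  linear-power a (suc p) = begin
    a * proj₂ (x ^ᴰ suc p) + 1# * proj₁ (x ^ᴰ suc p)
      ≈⟨ +-cong (*-congˡ (linear-power a p)) (*-congˡ (reflexive (Dual.^-proj₁ (Alg k) x (suc p)))) ⟩
    a * (scalar k (ℤ.+ suc p) * a ^ p) + 1# * (a * a ^ p)
      ≈⟨ solve 3 (λ a n z → a :* (n :* z) :+ con 1 :* (a :* z) := (con 1 :+ n) :* (a :* z)) refl a (scalar k (ℤ.+ suc p)) (a ^ p) ⟩
    (1# + scalar k (ℤ.+ suc p)) * (a * a ^ p)
      ≈⟨ *-congʳ (sym (scalar-suc k (suc p))) ⟩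
    scalar k (ℤ.+ suc (suc p)) * (a * a ^ p) ∎
    where x = (a , 1#)

-- Only the exponent p = 1 occurs in the application. It is kept free because every coordinate on
-- which the character depends raises it by one in the induction of `character-sum`.
character-term : ∀ k → ℕ → ℕ → Vec ℤ k → ∣Alg∣ k
character-term k s p c = scalar k (χ s c) * linear⁻¹ k c ^ p
  where
  open CommutativeSemiring (Alg k) hiding (zero)
  open Exp semiring using (_^_)

module _ (k : ℕ) (p : ℕ) where
  open CommutativeSemiring (Alg k) hiding (zero)
  open Exp semiring using (_^_)

  character-term-suc : ∀ s ε c → CommutativeSemiring._≈_ (Alg (suc k))
    (character-term (suc k) s p (ε ∷ c))
    ( scalar k (χ s (ε ∷ c)) * linear⁻¹ k c ^ p
    , scalar k (χ s (ε ∷ c)) * (scalar k (ℤ.+ p) * (scalar k (ℤ.- ε) * linear⁻¹ k c ^ suc p)))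
  character-term-suc s ε c
    = *-congˡ (reflexive (Dual.^-proj₁ (Alg k) _ p))
    , trans (+-cong (*-congˡ (inverse-power k (linear⁻¹ k c) (scalar k (ℤ.- ε)) p)) (zeroˡ _)) (+-identityʳ _)

1^ : ∀ p → Exp._^_ ℤₚ.+-*-semiring 1ℤ p ≡ 1ℤ
1^ zero    = ≡.refl
1^ (suc p) = ≡.trans (ℤₚ.*-identityˡ _) (1^ p)

-- Vectors that differ in the first sign are paired. For s = 0 the constant parts agree and the
-- y₁-parts are opposite; for larger s the extra sign swaps the two roles, and the surviving y₁-part
-- carries the factor 2 p with the exponent raised to p + 1.
character-sum : ∀ k s p → CommutativeSemiring._≈_ (Alg k)
  (FiniteSums.sum (Alg k) (character-term k s p) (cube k)) (monomial k s p)
character-sum zero    zero    p = ≡.trans (ℤₚ.+-identityʳ _) (≡.trans (ℤₚ.*-identityˡ _) (1^ p))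
character-sum zero    (suc s) p = ≡.trans (ℤₚ.+-identityʳ _) (≡.trans (ℤₚ.*-identityˡ _) (1^ p))
character-sum (suc k) zero    p = D.trans (sum-cube (Alg (suc k)) k (character-term (suc k) zero p))
  (D.trans (FiniteSums.sum-cong (Alg (suc k)) pair (cube k))
  (D.trans (D.reflexive (Dual.sum-dual (Alg k) _ _ (cube k)))
  ( trans (sum-*ˡ _ _ (cube k)) (*-congˡ (character-sum k zero p))
  , trans (sum-*ˡ 0# (λ _ → 0#) (cube k)) (zeroˡ _))))
  where
  open CommutativeSemiring (Alg k) hiding (zero)
  module D = CommutativeSemiring (Alg (suc k))
  open FiniteSums (Alg k)
  open Exp semiring using (_^_)
  open SemiringSolver (Alg k) using (solve; _:=_; _:+_; _:*_; con)
  e = scalar k 1ℤ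
  n = scalar k -1ℤ
  -- The vanishing component is written `0# * 0#` so that `sum-*ˡ` can pull a factor `0#` out of the
  -- sum.
  pair : ∀ c → character-term (suc k) zero p (1ℤ ∷ c) D.+ character-term (suc k) zero p (-1ℤ ∷ c)
             D.≈ (scalar k (ℤ.+ 2) * character-term k zero p c , 0# * 0#)
  pair c = D.trans (D.+-cong (character-term-suc k p zero 1ℤ c) (character-term-suc k p zero -1ℤ c))
    ( trans (solve 2 (λ e z → e :* z :+ e :* z := (e :+ e) :* z) refl e _)
        (trans (*-congʳ (sym (scalar-+ k 1ℤ 1ℤ))) (*-congˡ (trans (sym (*-identityˡ _)) (*-congʳ (sym (scalar-1 k))))))
    , trans (solve 4 (λ e n q z → e :* (q :* (n :* z)) :+ e :* (q :* (e :* z)) := (n :+ e) :* (e :* (q :* z)))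
          refl e n (scalar k (ℤ.+ p)) (linear⁻¹ k c ^ suc p))
        (trans (*-congʳ (scalar-inverse k 1ℤ)) (trans (zeroˡ _) (sym (zeroˡ 0#)))))
character-sum (suc k) (suc s) p = D.trans (sum-cube (Alg (suc k)) k (character-term (suc k) (suc s) p))
  (D.trans (FiniteSums.sum-cong (Alg (suc k)) pair (cube k))
  (D.trans (D.reflexive (Dual.sum-dual (Alg k) _ _ (cube k)))
  ( trans (sum-*ˡ 0# (λ _ → 0#) (cube k)) (zeroˡ _)
  , trans (sum-*ˡ _ _ (cube k)) (*-congˡ (character-sum k s (suc p))))))
  where
  open CommutativeSemiring (Alg k) hiding (zero)
  module D = CommutativeSemiring (Alg (suc k))
  open import Relation.Binary.Reasoning.Setoid setoid
  open FiniteSums (Alg k)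
  open Exp semiring using (_^_)
  open SemiringSolver (Alg k) using (solve; _:=_; _:+_; _:*_; con)
  e = scalar k 1ℤ
  n = scalar k -1ℤ
  q = scalar k (ℤ.+ p)
  double : scalar k (ℤ.+ (2 ℕ.* p)) ≈ (1# + 1#) * q
  double = trans (reflexive (≡.cong (scalar k) (ℤₚ.pos-* 2 p)))
    (trans (scalar-* k (ℤ.+ 2) (ℤ.+ p)) (*-congʳ (trans (scalar-+ k 1ℤ 1ℤ) (+-cong (scalar-1 k) (scalar-1 k)))))
  pair : ∀ c → character-term (suc k) (suc s) p (1ℤ ∷ c) D.+ character-term (suc k) (suc s) p (-1ℤ ∷ c)
             D.≈ (0# * 0# , scalar k (ℤ.+ (2 ℕ.* p)) * character-term k s (suc p) c)
  pair c = D.trans (D.+-cong (character-term-suc k p (suc s) 1ℤ c) (character-term-suc k p (suc s) -1ℤ c))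
    ( (begin
      scalar k (-1ℤ ℤ.* t) * z + scalar k (1ℤ ℤ.* t) * z
        ≈⟨ +-cong (*-congʳ (scalar-* k -1ℤ t)) (*-congʳ (scalar-* k 1ℤ t)) ⟩
      n * x * z + e * x * z
        ≈⟨ solve 4 (λ e n x z → n :* x :* z :+ e :* x :* z := (n :+ e) :* (x :* z)) refl e n x z ⟩
      (n + e) * (x * z)
        ≈⟨ *-congʳ (scalar-inverse k 1ℤ) ⟩
      0# * (x * z)
        ≈⟨ trans (zeroˡ _) (sym (zeroˡ 0#)) ⟩
      0# * 0# ∎)
    , (begin
      scalar k (-1ℤ ℤ.* t) * (q * (n * z′)) + scalar k (1ℤ ℤ.* t) * (q * (e * z′))
        ≈⟨ +-cong (*-congʳ (scalar-* k -1ℤ t)) (*-congʳ (scalar-* k 1ℤ t)) ⟩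
      n * x * (q * (n * z′)) + e * x * (q * (e * z′))
        ≈⟨ solve 5 (λ e n x q z → n :* x :* (q :* (n :* z)) :+ e :* x :* (q :* (e :* z))
                               := (n :* n :+ e :* e) :* q :* (x :* z)) refl e n x q z′ ⟩
      (n * n + e * e) * q * (x * z′)
        ≈⟨ *-congʳ (*-congʳ (+-cong (trans (sym (scalar-* k -1ℤ -1ℤ)) (scalar-1 k))
                                    (trans (sym (scalar-* k 1ℤ 1ℤ)) (scalar-1 k)))) ⟩
      (1# + 1#) * q * (x * z′)
        ≈⟨ *-congʳ (sym double) ⟩
      scalar k (ℤ.+ (2 ℕ.* p)) * (x * z′) ∎))
    where
    t = χ s c
    x = scalar k t
    z = linear⁻¹ k c ^ p
    z′ = linear⁻¹ k c ^ suc p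

-- Top coefficients of monomials times powers of `ones`.

-- weight k s N p = 2ᵏ · p(p+1)⋯(p+s-1) · N(N-1)⋯(N-k+s+1) for s ≤ k
weight : ℕ → ℕ → ℕ → ℕ → ℕ
weight zero    s       N p = 1
weight (suc k) zero    N p = 2 ℕ.* (N ℕ.* weight k zero (ℕ.pred N) p)
weight (suc k) (suc s) N p = 2 ℕ.* p ℕ.* weight k s N (suc p)

ones : ∀ k → ∣Alg∣ k
ones k = linear k (replicate k 1ℤ)

-- Each of the first s variables comes from the monomial, with the factor 2 p. Each later one has to
-- come from the power of `ones`: its derivative gives the factor N and lowers the exponent, while
-- the monomial adds the factor 2.
top-ones-monomial : ∀ k s N p → let open CommutativeSemiring (Alg k); open Exp semiring using (_^_) in
  top k (ones k ^ N * monomial k s p) ≡ ℤ.+ weight k s N p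
top-ones-monomial zero    s       N p = ≡.trans (ℤₚ.*-identityʳ _) (1^ N)
top-ones-monomial (suc k) zero    zero p = ≡.trans
  (top-cong k (trans (+-congˡ (zeroˡ _)) (trans (+-identityʳ _) (zeroʳ _)))) (top-0 k)
  where open CommutativeSemiring (Alg k) hiding (zero)
top-ones-monomial (suc k) zero    (suc N) p = begin
  top k (proj₁ (x ^ᴰ suc N) * 0# + proj₂ (x ^ᴰ suc N) * (scalar k (ℤ.+ 2) * m))
    -- The y-part of `ones (suc k)` is `scalar k 1ℤ`; it is exchanged for `1#` before `linear-power`
    -- applies.
    ≡⟨ top-cong k (trans (+-cong (zeroʳ _) (*-congʳ (trans (proj₂ (Exp.^-congˡ (CommutativeSemiring.semiring (Alg (suc k))) (suc N) (refl , scalar-1 k))) (linear-power k (ones k) N)))) (+-identityˡ _)) ⟩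
  top k ((scalar k (ℤ.+ suc N) * ones k ^ N) * (scalar k (ℤ.+ 2) * m))
    ≡⟨ top-cong k (solve 4 (λ a b c d → (a :* b) :* (c :* d) := c :* (a :* (b :* d))) refl _ _ _ _) ⟩
  top k (scalar k (ℤ.+ 2) * (scalar k (ℤ.+ suc N) * (ones k ^ N * m)))
    ≡⟨ ≡.trans (top-scalar k (ℤ.+ 2) _) (≡.cong (ℤ.+ 2 ℤ.*_) (top-scalar k (ℤ.+ suc N) _)) ⟩
  ℤ.+ 2 ℤ.* (ℤ.+ suc N ℤ.* top k (ones k ^ N * m))
    ≡⟨ ≡.cong (λ w → ℤ.+ 2 ℤ.* (ℤ.+ suc N ℤ.* w)) (top-ones-monomial k zero N p) ⟩
  ℤ.+ 2 ℤ.* (ℤ.+ suc N ℤ.* ℤ.+ weight k zero N p)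
    ≡⟨ ≡.cong (ℤ.+ 2 ℤ.*_) (≡.sym (ℤₚ.pos-* (suc N) _)) ⟩
  ℤ.+ 2 ℤ.* ℤ.+ (suc N ℕ.* weight k zero N p)
    ≡⟨ ≡.sym (ℤₚ.pos-* 2 (suc N ℕ.* weight k zero N p)) ⟩
  ℤ.+ weight (suc k) zero (suc N) p ∎
  where
  open ≡.≡-Reasoning
  open CommutativeSemiring (Alg k) hiding (zero)
  open SemiringSolver (Alg k) using (solve; _:=_; _:*_)
  open Exp semiring using (_^_)
  open Exp (CommutativeSemiring.semiring (Alg (suc k))) using () renaming (_^_ to _^ᴰ_)
  x = ones (suc k)
  m = monomial k zero p
top-ones-monomial (suc k) (suc s) N p = begin
  top k (proj₁ (x ^ᴰ N) * (scalar k (ℤ.+ (2 ℕ.* p)) * m) + proj₂ (x ^ᴰ N) * 0#)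
    ≡⟨ top-cong k (trans (+-cong (*-congʳ (reflexive (Dual.^-proj₁ (Alg k) x N))) (zeroʳ _)) (+-identityʳ _)) ⟩
  top k (ones k ^ N * (scalar k (ℤ.+ (2 ℕ.* p)) * m))
    ≡⟨ top-cong k (solve 3 (λ a b c → a :* (b :* c) := b :* (a :* c)) refl _ _ _) ⟩
  top k (scalar k (ℤ.+ (2 ℕ.* p)) * (ones k ^ N * m))
    ≡⟨ top-scalar k (ℤ.+ (2 ℕ.* p)) _ ⟩
  ℤ.+ (2 ℕ.* p) ℤ.* top k (ones k ^ N * m)
    ≡⟨ ≡.cong (ℤ.+ (2 ℕ.* p) ℤ.*_) (top-ones-monomial k s N (suc p)) ⟩
  ℤ.+ (2 ℕ.* p) ℤ.* ℤ.+ weight k s N (suc p)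
    ≡⟨ ≡.sym (ℤₚ.pos-* (2 ℕ.* p) _) ⟩
  ℤ.+ weight (suc k) (suc s) N p ∎
  where
  open ≡.≡-Reasoning
  open CommutativeSemiring (Alg k) hiding (zero)
  open SemiringSolver (Alg k) using (solve; _:=_; _:*_)
  open Exp semiring using (_^_)
  open Exp (CommutativeSemiring.semiring (Alg (suc k))) using () renaming (_^_ to _^ᴰ_)
  x = ones (suc k)
  m = monomial k s (suc p)

-- Laplace expansion of the permanent.

module _ where
  open FiniteSums (Alg 0) using (sum; sum-++; sum-map; sum-cong-local; sum-cong; sum-*ˡ)

  sumℤ-map : {X : Set} (f : X → ℤ) → ∀ xs → sumℤ (map f xs) ≡ sum f xs
  sumℤ-map f []       = ≡.refl
  sumℤ-map f (x ∷ xs) = ≡.cong (λ t → f x ℤ.+ t) (sumℤ-map f xs)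

  module _ {n : ℕ} where

    along : ∀ {k} → Vec (Vec ℤ n) k → Vec (Fin n) k → ℤ
    along []      []      = 1ℤ
    along (a ∷ A) (x ∷ σ) = lookup a x ℤ.* along A σ

    -- The index map h is general so that the induction can pass to `h ∘ Fin.suc`: A and σ lose
    -- their heads while g keeps referring to the original matrix.
    prodℤ-along : ∀ {k m} (A : Vec (Vec ℤ n) k) σ (g : Fin m → ℤ) h →
                  (∀ i → g (h i) ≡ lookup (lookup A i) (lookup σ i)) →
                  prodℤ (map g (toList (Vec.tabulate h))) ≡ along A σ
    prodℤ-along []      []      g h eq = ≡.refl
    prodℤ-along (a ∷ A) (x ∷ σ) g h eq =
      ≡.cong₂ ℤ._*_ (eq Fin.zero) (prodℤ-along A σ g (h ∘ Fin.suc) (eq ∘ Fin.suc))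

    unique? : ∀ {k} → Decidable (λ (v : Vec (Fin n) k) → Unique (toList v))
    unique? v = UniqueDec.unique? Finₚ._≟_ (toList v)

    avoids? : ∀ {k} x → Decidable (λ (v : Vec (Fin n) k) → All (x ≢_) (toList v))
    avoids? x v = All.all? (λ y → ¬? (x Finₚ.≟ y)) (toList v)

    differs? : ∀ (x : Fin n) → Decidable (x ≢_)
    differs? x y = ¬? (x Finₚ.≟ y)

    -- The uniqueness test on `x ∷ v` computes to the conjunction of the avoidance test and the
    -- uniqueness test on v.
    filter-unique-∷ : ∀ {k} x (vs : List (Vec (Fin n) k)) →
      filter unique? (map (x ∷_) vs) ≡ map (x ∷_) (filter unique? (filter (avoids? x) vs))
    filter-unique-∷ x []       = ≡.refl
    filter-unique-∷ x (v ∷ vs) with does (avoids? x v)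
    ... | false = filter-unique-∷ x vs
    ... | true  with does (unique? v)
    ...   | false = filter-unique-∷ x vs
    ...   | true  = ≡.cong ((x ∷ v) ∷_) (filter-unique-∷ x vs)

    filter-avoids-∷ : ∀ {k} x y (vs : List (Vec (Fin n) k)) →
      filter (avoids? x) (map (y ∷_) vs)
        ≡ (if does (x Finₚ.≟ y) then [] else map (y ∷_) (filter (avoids? x) vs))
    filter-avoids-∷ x y []       with does (x Finₚ.≟ y)
    ... | true  = ≡.refl
    ... | false = ≡.refl
    filter-avoids-∷ x y (v ∷ vs) with does (x Finₚ.≟ y) | filter-avoids-∷ x y vs
    ... | true  | ih = ih
    ... | false | ih with does (avoids? x v)
    ...   | false = ih
    ...   | true  = ≡.cong ((y ∷ v) ∷_) ih

    filter-avoids-concatMap : ∀ {k} x L (vs : List (Vec (Fin n) k)) →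
      filter (avoids? x) (concatMap (λ y → map (y ∷_) vs) L)
        ≡ concatMap (λ y → map (y ∷_) (filter (avoids? x) vs)) (filter (differs? x) L)
    filter-avoids-concatMap x []      vs = ≡.refl
    filter-avoids-concatMap x (y ∷ L) vs = ≡.trans
      (Listₚ.filter-++ (avoids? x) (map (y ∷_) vs) _)
      (≡.trans (≡.cong₂ _++_ (filter-avoids-∷ x y vs) (filter-avoids-concatMap x L vs)) step)
      where
      step : (if does (x Finₚ.≟ y) then [] else map (y ∷_) (filter (avoids? x) vs))
               ++ concatMap (λ y → map (y ∷_) (filter (avoids? x) vs)) (filter (differs? x) L)
             ≡ concatMap (λ y → map (y ∷_) (filter (avoids? x) vs)) (filter (differs? x) (y ∷ L))
      step with does (x Finₚ.≟ y)
      ... | true  = ≡.refl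
      ... | false = ≡.refl

    filter-avoids-allVecs : ∀ x L k →
      filter (avoids? x) (allVecs L k) ≡ allVecs (filter (differs? x) L) k
    filter-avoids-allVecs x L zero    = ≡.refl
    filter-avoids-allVecs x L (suc k) = ≡.trans (filter-avoids-concatMap x L (allVecs L k))
      (≡.cong (λ vs → concatMap (λ y → map (y ∷_) vs) (filter (differs? x) L)) (filter-avoids-allVecs x L k))

    -- Without repetitions, deleting x by value is the same as deleting it by position. Deletion by
    -- value comes from the definition of `permutations`; deletion by position matches
    -- `prod-leibniz`.
    picks-unique : ∀ {L} → Unique L → map (λ x → x , filter (differs? x) L) L ≡ picks L
    picks-unique {[]}    []          = ≡.refl
    picks-unique {x ∷ L} (x∉L ∷ uL) = ≡.cong₂ _∷_
      (≡.cong (x ,_) (≡.trans (Listₚ.filter-reject (differs? x) (λ x≢x → x≢x ≡.refl)) (Listₚ.filter-all (differs? x) x∉L)))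
      (≡.trans (Listₚ.map-cong-local (All.map (λ {y} x≢y → ≡.cong (y ,_) (Listₚ.filter-accept (differs? y) (x≢y ∘ ≡.sym))) x∉L))
        (≡.trans (Listₚ.map-∘ L) (≡.cong (map (map₂ (x ∷_))) (picks-unique uL))))

    -- Iterated Laplace expansion, where L lists the columns that are still free. The sum runs over
    -- the injective choices of a position in L for each row.
    expansion : ∀ {k} → Vec (Vec ℤ n) k → List (Fin n) → ℤ
    expansion []      L = 1ℤ
    expansion (a ∷ A) L = sum (λ (x , L′) → lookup a x ℤ.* expansion A L′) (picks L)

    sum-unique-∷ : ∀ {k} (a : Vec ℤ n) (A : Vec (Vec ℤ n) k) x (vs : List (Vec (Fin n) k)) →
      sum (along (a ∷ A)) (filter unique? (map (x ∷_) vs))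
        ≡ lookup a x ℤ.* sum (along A) (filter unique? (filter (avoids? x) vs))
    sum-unique-∷ a A x vs = ≡.trans (≡.cong (sum (along (a ∷ A))) (filter-unique-∷ x vs))
      (≡.trans (sum-map (x ∷_) (along (a ∷ A)) (filter unique? (filter (avoids? x) vs)))
               (sum-*ˡ (lookup a x) (along A) (filter unique? (filter (avoids? x) vs))))

    sum-unique-concatMap : ∀ {k} (a : Vec ℤ n) (A : Vec (Vec ℤ n) k) (vs : List (Vec (Fin n) k)) L →
      sum (along (a ∷ A)) (filter unique? (concatMap (λ x → map (x ∷_) vs) L))
        ≡ sum (λ x → lookup a x ℤ.* sum (along A) (filter unique? (filter (avoids? x) vs))) L
    sum-unique-concatMap a A vs []      = ≡.refl
    sum-unique-concatMap a A vs (x ∷ L) = ≡.trans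
      (≡.cong (sum (along (a ∷ A))) (Listₚ.filter-++ unique? (map (x ∷_) vs) _))
      (≡.trans (sum-++ (along (a ∷ A)) (filter unique? (map (x ∷_) vs)) _)
               (≡.cong₂ ℤ._+_ (sum-unique-∷ a A x vs) (sum-unique-concatMap a A vs L)))

    -- Once the first entry x is fixed, the admissible remainders are the repetition-free vectors
    -- over L without x, so the induction continues with a smaller alphabet.
    sum-permutations : ∀ {k} (A : Vec (Vec ℤ n) k) {L} → Unique L →
      sum (along A) (filter unique? (allVecs L k)) ≡ expansion A L
    sum-permutations []      uL = ≡.refl
    sum-permutations (a ∷ A) {L} uL = begin
      sum (along (a ∷ A)) (filter unique? (allVecs L _))
        ≡⟨ sum-unique-concatMap a A (allVecs L _) L ⟩
      sum (λ x → lookup a x ℤ.* sum (along A) (filter unique? (filter (avoids? x) (allVecs L _)))) L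
        ≡⟨ sum-cong (λ x → ≡.cong (λ vs → lookup a x ℤ.* sum (along A) (filter unique? vs)) (filter-avoids-allVecs x L _)) L ⟩
      sum (λ x → lookup a x ℤ.* sum (along A) (filter unique? (allVecs (filter (differs? x) L) _))) L
        ≡⟨ sum-cong (λ x → ≡.cong (lookup a x ℤ.*_) (sum-permutations A (Uniqueₚ.filter⁺ (differs? x) uL))) L ⟩
      sum (λ x → lookup a x ℤ.* expansion A (filter (differs? x) L)) L
        ≡⟨ ≡.sym (sum-map (λ x → x , filter (differs? x) L) (λ (x , L′) → lookup a x ℤ.* expansion A L′) L) ⟩
      sum (λ (x , L′) → lookup a x ℤ.* expansion A L′) (map (λ x → x , filter (differs? x) L) L)
        ≡⟨ ≡.cong (sum (λ (x , L′) → lookup a x ℤ.* expansion A L′)) (picks-unique uL) ⟩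
      expansion (a ∷ A) L ∎
      where open ≡.≡-Reasoning

  toList-tabulate : ∀ {X : Set} {n} (f : Fin n → X) → toList (Vec.tabulate f) ≡ List.tabulate f
  toList-tabulate {n = zero}  f = ≡.refl
  toList-tabulate {n = suc n} f = ≡.cong (f Fin.zero ∷_) (toList-tabulate (f ∘ Fin.suc))

  per-expansion : ∀ {n} (A : Matrix n) → per A ≡ expansion A (List.allFin n)
  per-expansion {n} A = begin
    per A
      ≡⟨ sumℤ-map _ (permutations n) ⟩
    sum (λ σ → prodℤ (map (λ i → lookup (lookup A i) (lookup σ i)) (toList (Vec.allFin n)))) (permutations n)
      ≡⟨ sum-cong (λ σ → prodℤ-along A σ (λ i → lookup (lookup A i) (lookup σ i)) id (λ _ → ≡.refl)) (permutations n) ⟩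
    sum (along A) (permutations n)
      ≡⟨ ≡.cong (λ L → sum (along A) (filter unique? (allVecs L n))) (toList-tabulate id) ⟩
    sum (along A) (filter unique? (allVecs (List.allFin n) n))
      ≡⟨ sum-permutations A (Uniqueₚ.allFin⁺ n) ⟩
    expansion A (List.allFin n) ∎
    where open ≡.≡-Reasoning

  -- Permanents of matrices with constant rows as coefficients.

  length-picks : {X : Set} (L : List X) → length (picks L) ≡ length L
  length-picks []      = ≡.refl
  length-picks (x ∷ L) = ≡.cong suc (≡.trans (Listₚ.length-map _ (picks L)) (length-picks L))

  picks-length : {X : Set} (L : List X) → All (λ (x , L′) → suc (length L′) ≡ length L) (picks L)
  picks-length []      = []
  picks-length (x ∷ L) = ≡.refl ∷ Allₚ.map⁺ (All.map (≡.cong suc) (picks-length L))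

  sum-const : {X : Set} (c : ℤ) (L : List X) → sum (λ _ → c) L ≡ ℤ.+ length L ℤ.* c
  sum-const c []      = ≡.refl
  sum-const c (x ∷ L) = ≡.trans (≡.cong (λ t → c ℤ.+ t) (sum-const c L))
    (≡.sym (ℤₚ.suc-* (ℤ.+ length L) c))

  top-sum : ∀ k {X : Set} (f : X → ∣Alg∣ k) L → top k (FiniteSums.sum (Alg k) f L) ≡ sum (top k ∘ f) L
  top-sum k f []      = top-0 k
  top-sum k f (x ∷ L) = ≡.trans (top-+ k (f x) _) (≡.cong (λ t → top k (f x) ℤ.+ t) (top-sum k f L))

  head∷tail : ∀ {X : Set} {k} (xs : Vec X (suc k)) → head xs ∷ tail xs ≡ xs
  head∷tail (x ∷ xs) = ≡.refl

  allFin-lookup : ∀ {X : Set} {n} (xs : Vec X n) → map (lookup xs) (List.allFin n) ≡ toList xs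
  allFin-lookup xs = ≡.trans (Listₚ.map-tabulate id (lookup xs))
    (≡.trans (≡.sym (toList-tabulate (lookup xs))) (≡.cong toList (Vecₚ.tabulate∘lookup xs)))

  module _ {n : ℕ} where

    rows-of-ones : ∀ q → Vec (Vec ℤ n) q
    rows-of-ones q = replicate q (replicate n 1ℤ)

    expansion-ones : ∀ q L → length L ≡ q → expansion (rows-of-ones q) L ≡ ℤ.+ (q !)
    expansion-ones zero    L _  = ≡.refl
    expansion-ones (suc q) L eq = begin
      sum (λ (x , L′) → lookup (replicate n 1ℤ) x ℤ.* expansion (rows-of-ones q) L′) (picks L)
        ≡⟨ sum-cong-local (All.map (λ {(x , L′)} eq′ → ≡.trans
             (≡.cong₂ ℤ._*_ (Vecₚ.lookup-replicate x 1ℤ) (expansion-ones q L′ (ℕₚ.suc-injective (≡.trans eq′ eq))))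
             (ℤₚ.*-identityˡ _)) (picks-length L)) ⟩
      sum (λ _ → ℤ.+ (q !)) (picks L)
        ≡⟨ sum-const (ℤ.+ (q !)) (picks L) ⟩
      ℤ.+ length (picks L) ℤ.* ℤ.+ (q !)
        ≡⟨ ≡.cong (λ l → ℤ.+ l ℤ.* ℤ.+ (q !)) (≡.trans (length-picks L) eq) ⟩
      ℤ.+ suc q ℤ.* ℤ.+ (q !)
        ≡⟨ ≡.sym (ℤₚ.pos-* (suc q) (q !)) ⟩
      ℤ.+ (suc q !) ∎
      where open ≡.≡-Reasoning

    column : ∀ {k} → Vec (Vec ℤ n) k → Fin n → Vec ℤ k
    column A j = Vec.map (λ a → lookup a j) A

    -- Laplace expansion along the first row is the product rule in y₁: the column chosen for this
    -- row gives its y₁-coefficient and the other columns pass on to the remaining rows. When only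
    -- rows of ones are left, every one of the q! assignments counts 1.
    expansion-top : ∀ {k} (A : Vec (Vec ℤ n) k) q L → length L ≡ k ℕ.+ q →
      expansion (A Vec.++ rows-of-ones q) L ≡ ℤ.+ (q !) ℤ.* top k (FiniteSums.prod (Alg k) (linear k ∘ column A) L)
    expansion-top {zero} [] q L eq = ≡.trans (expansion-ones q L eq)
      (≡.sym (≡.trans (≡.cong (ℤ.+ (q !) ℤ.*_) (prod-1 L)) (ℤₚ.*-identityʳ _)))
      where
      prod-1 : ∀ L → FiniteSums.prod (Alg 0) (linear 0 ∘ column []) L ≡ 1ℤ
      prod-1 []      = ≡.refl
      prod-1 (x ∷ L) = ≡.trans (ℤₚ.*-identityˡ _) (prod-1 L)
    expansion-top {suc k} (a ∷ A) q L eq = begin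
      sum (λ (x , L′) → lookup a x ℤ.* expansion (A Vec.++ rows-of-ones q) L′) (picks L)
        ≡⟨ sum-cong-local (All.map (λ {(x , L′)} eq′ → ≡.trans
             (≡.cong (lookup a x ℤ.*_) (expansion-top A q L′ (ℕₚ.suc-injective (≡.trans eq′ eq))))
             (swap (lookup a x) (ℤ.+ (q !)) (top k (prod (linear k ∘ column A) L′)))) (picks-length L)) ⟩
      sum (λ (x , L′) → ℤ.+ (q !) ℤ.* (lookup a x ℤ.* top k (prod (linear k ∘ column A) L′))) (picks L)
        ≡⟨ sum-*ˡ (ℤ.+ (q !)) _ (picks L) ⟩
      ℤ.+ (q !) ℤ.* sum (λ (x , L′) → lookup a x ℤ.* top k (prod (linear k ∘ column A) L′)) (picks L)
        ≡⟨ ≡.cong (ℤ.+ (q !) ℤ.*_) (sum-cong (λ (x , L′) → ≡.sym (top-scalar k (lookup a x) _)) (picks L)) ⟩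
      ℤ.+ (q !) ℤ.* sum (λ (x , L′) → top k (scalar k (lookup a x) * prod (linear k ∘ column A) L′)) (picks L)
        ≡⟨ ≡.cong (ℤ.+ (q !) ℤ.*_) (≡.sym (top-sum k _ (picks L))) ⟩
      ℤ.+ (q !) ℤ.* top k (FiniteSums.sum (Alg k) (λ (x , L′) → scalar k (lookup a x) * prod (linear k ∘ column A) L′) (picks L))
        ≡⟨ ≡.cong (ℤ.+ (q !) ℤ.*_) (top-cong k (sym (Dual.prod-leibniz (Alg k) (linear k ∘ column A) (scalar k ∘ lookup a) L))) ⟩
      ℤ.+ (q !) ℤ.* top (suc k) (FiniteSums.prod (Alg (suc k)) (linear (suc k) ∘ column (a ∷ A)) L) ∎
      where
      open ≡.≡-Reasoning
      open CommutativeSemiring (Alg k) using (_*_; sym)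
      open FiniteSums (Alg k) using (prod)
      swap : ∀ x y z → x ℤ.* (y ℤ.* z) ≡ y ℤ.* (x ℤ.* z)
      swap x y z = ≡.trans (≡.sym (ℤₚ.*-assoc x y z)) (≡.trans (≡.cong (ℤ._* z) (ℤₚ.*-comm x y)) (ℤₚ.*-assoc y x z))

    transpose : ∀ {k} → Vec (Vec ℤ k) n → Vec (Vec ℤ n) k
    transpose {zero}  cs = []
    transpose {suc k} cs = Vec.map head cs ∷ transpose (Vec.map tail cs)

    column-transpose : ∀ {k} (cs : Vec (Vec ℤ k) n) j → column (transpose cs) j ≡ lookup cs j
    column-transpose {zero}  cs j with lookup cs j
    ... | [] = ≡.refl
    column-transpose {suc k} cs j = ≡.trans
      (≡.cong₂ _∷_ (Vecₚ.lookup-map j head cs) (≡.trans (column-transpose (Vec.map tail cs) j) (Vecₚ.lookup-map j tail cs)))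
      (head∷tail (lookup cs j))

  replicate⁺ : ∀ {X : Set} {P : X → Set} {x} n → P x → VAll.All P (replicate n x)
  replicate⁺ zero    px = VAll.[]
  replicate⁺ (suc n) px = px VAll.∷ replicate⁺ n px

  signs : List ℤ
  signs = 1ℤ ∷ -1ℤ ∷ []

  allVecs-∈ : {X : Set} {xs : List X} {k : ℕ} {v : Vec X k} → VAll.All (_∈ xs) v → v ∈ allVecs xs k
  allVecs-∈ VAll.[]         = here ≡.refl
  allVecs-∈ (x∈ VAll.∷ v∈) = ∈ₚ.∈-concatMap⁺ _ (Any.map (λ { ≡.refl → ∈ₚ.∈-map⁺ (_ ∷_) (allVecs-∈ v∈) }) x∈)

  transpose-signs : ∀ {n k} (cs : Vec (Vec ℤ k) n) → VAll.All (VAll.All (_∈ signs)) cs →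
                    VAll.All (_∈ allVecs signs n) (transpose cs)
  transpose-signs {k = zero}  cs cs∈ = VAll.[]
  transpose-signs {k = suc k} cs cs∈ =
    allVecs-∈ (VAllₚ.map⁺ (VAll.map (λ { (s VAll.∷ _) → s }) cs∈)) VAll.∷
    transpose-signs (Vec.map tail cs) (VAllₚ.map⁺ (VAll.map (λ { (_ VAll.∷ ss) → ss }) cs∈))

  -- The vectors in cs are the top parts of the columns, and q rows of ones complete the matrix.
  -- From here on only lists of sign vectors have to be constructed.
  permanent-attained : ∀ {n k} q (cs : Vec (Vec ℤ k) n) → n ≡ k ℕ.+ q → VAll.All (VAll.All (_∈ signs)) cs →
    ℤ.+ (q !) ℤ.* top k (FiniteSums.prod (Alg k) (linear k) (toList cs)) ∈ map per (Ω n)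
  permanent-attained {n} {k} q cs ≡.refl cs∈ = ≡.subst (_∈ map per (Ω n)) value
    (∈ₚ.∈-map⁺ per (allVecs-∈ (VAllₚ.++⁺ (transpose-signs cs cs∈)
      (replicate⁺ q (allVecs-∈ (replicate⁺ n (here ≡.refl)))))))
    where
    open FiniteSums (Alg k) using (prod; prod-cong; prod-map)
    module A = CommutativeSemiring (Alg k)
    value : per (transpose cs Vec.++ rows-of-ones q) ≡ ℤ.+ (q !) ℤ.* top k (prod (linear k) (toList cs))
    value = ≡.trans (per-expansion (transpose cs Vec.++ rows-of-ones q))
      (≡.trans (expansion-top (transpose cs) q (List.allFin n) (Listₚ.length-tabulate id))
      (≡.cong (ℤ.+ (q !) ℤ.*_) (top-cong k
        (A.trans (prod-cong (λ j → A.reflexive (≡.cong (linear k) (column-transpose cs j))) (List.allFin n))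
        (A.trans (A.reflexive (≡.sym (prod-map (lookup cs) (linear k) (List.allFin n))))
                 (A.reflexive (≡.cong (prod (linear k)) (allFin-lookup cs))))))))

-- Blocks of columns and their additive contributions.

module _ (k : ℕ) where

  -- The additional row comes first, so that its variable is the outermost one and the effect of a
  -- block is a derivative over `Alg k`.
  block : ℤ → ℕ → List (Vec ℤ (suc k))
  block c s = map (λ y → (c ℤ.* χ s y) ∷ y) (cube k)

  blocks : ℕ → ℤ → ℕ → List (Vec ℤ (suc k))
  blocks zero    c s = []
  blocks (suc j) c s = block c s ++ blocks j c s

  -- The digit e at position i turns into e blocks with sign + and m - e blocks with sign -,
  -- hence into the contribution 2 e - m times the weight at i.
  digitColumns : ∀ m {d} → ℕ → Vec (Fin (suc m)) d → List (Vec ℤ (suc k))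
  digitColumns m i []       = []
  digitColumns m i (e ∷ es) = blocks (toℕ e) 1ℤ i ++ (blocks (m ℕ.∸ toℕ e) -1ℤ i ++ digitColumns m (suc i) es)

-- By `prod-cube` the constant part is 1, so the derivative equals the logarithmic derivative, which
-- is c times the character sum with exponent 1.
prod-block : ∀ k c s → CommutativeSemiring._≈_ (Alg (suc k))
  (FiniteSums.prod (Alg (suc k)) (linear (suc k)) (block k c s))
  (CommutativeSemiring.1# (Alg k) , CommutativeSemiring._*_ (Alg k) (scalar k c) (monomial k s 1))
prod-block k c s = D.trans
  (D.reflexive (FiniteSums.prod-map (Alg (suc k)) (λ y → (c ℤ.* χ s y) ∷ y) (linear (suc k)) (cube k)))
  ( trans (reflexive (Dual.prod-proj₁ (Alg k) (linear k) tag (cube k))) (prod-cube k)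
  , (begin
    proj₂ (FiniteSums.prod (Alg (suc k)) (λ y → linear k y , tag y) (cube k))
      ≈⟨ Dual.prod-logarithmic (Alg k) (linear k) tag (linear⁻¹ k) (linear-inverse k) (cube k) ⟩
    prod (linear k) (cube k) * sum (λ y → tag y * linear⁻¹ k y) (cube k)
      ≈⟨ *-cong (prod-cube k) (sum-cong (λ y → trans (*-congʳ (scalar-* k c (χ s y)))
           -- The last rewriting turns an inverse into its first power, which unfolds to a product
           -- with `1#`.
           (trans (*-assoc _ _ _) (*-congˡ (*-congˡ (sym (*-identityʳ _)))))) (cube k)) ⟩
    1# * sum (λ y → scalar k c * character-term k s 1 y) (cube k)
      ≈⟨ trans (*-identityˡ _) (sum-*ˡ (scalar k c) (character-term k s 1) (cube k)) ⟩
    scalar k c * sum (character-term k s 1) (cube k)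
      ≈⟨ *-congˡ (character-sum k s 1) ⟩
    scalar k c * monomial k s 1 ∎))
  where
  open CommutativeSemiring (Alg k) hiding (zero)
  module D = CommutativeSemiring (Alg (suc k))
  open import Relation.Binary.Reasoning.Setoid setoid
  open FiniteSums (Alg k)
  tag : Vec ℤ k → Carrier
  tag y = scalar k (c ℤ.* χ s y)

module _ (k N : ℕ) where
  open CommutativeSemiring (Alg k) hiding (zero)
  open Exp semiring using (_^_)
  private
    module D = CommutativeSemiring (Alg (suc k))
    module Dᵉ = Exp D.semiring
  open FiniteSums (Alg (suc k)) using (prod; prod-++)

  -- Adjoined to N columns of ones, the columns in L change the coefficient top by v.
  Contributes : List (Vec ℤ (suc k)) → ℤ → Set
  Contributes L v = ∃ λ u → prod (linear (suc k)) L D.≈ (1# , u) × top k (ones k ^ N * u) ≡ v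

  contributes-[] : Contributes [] ℤ.0ℤ
  contributes-[] = 0# , D.refl , ≡.trans (top-cong k (zeroʳ _)) (top-0 k)

  -- As y² = 0, the product of 1 + u y and 1 + u′ y is 1 + (u + u′) y, so blocks combine additively.
  contributes-++ : ∀ {L L′ v v′} → Contributes L v → Contributes L′ v′ → Contributes (L ++ L′) (v ℤ.+ v′)
  contributes-++ {L} {L′} (u , p , q) (u′ , p′ , q′) = u + u′
    , D.trans (prod-++ (linear (suc k)) L L′) (D.trans (D.*-cong p p′)
        (*-identityˡ _ , trans (+-cong (*-identityˡ _) (*-identityʳ _)) (+-comm _ _)))
    , ≡.trans (top-cong k (distribˡ _ u u′)) (≡.trans (top-+ k _ _) (≡.cong₂ ℤ._+_ q q′))

  contributes-block : ∀ c s → Contributes (block k c s) (c ℤ.* ℤ.+ weight k s N 1)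
  contributes-block c s = scalar k c * monomial k s 1 , prod-block k c s
    , ≡.trans (top-cong k (trans (sym (*-assoc _ _ _)) (trans (*-congʳ (*-comm _ _)) (*-assoc _ _ _))))
        (≡.trans (top-scalar k c _) (≡.cong (c ℤ.*_) (top-ones-monomial k s N 1)))

  contributes-blocks : ∀ j c s → Contributes (blocks k j c s) (ℤ.+ j ℤ.* (c ℤ.* ℤ.+ weight k s N 1))
  contributes-blocks zero    c s = contributes-[]
  contributes-blocks (suc j) c s = ≡.subst (Contributes (blocks k (suc j) c s))
    (≡.sym (ℤₚ.suc-* (ℤ.+ j) _)) (contributes-++ {block k c s} {blocks k j c s} (contributes-block c s) (contributes-blocks j c s))

  columnsOfOnes : List (Vec ℤ (suc k))
  columnsOfOnes = List.replicate N (replicate (suc k) 1ℤ)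

  prod-columnsOfOnes : ∀ j → prod (linear (suc k)) (List.replicate j (replicate (suc k) 1ℤ)) ≡ ones (suc k) Dᵉ.^ j
  prod-columnsOfOnes zero    = ≡.refl
  prod-columnsOfOnes (suc j) = ≡.cong (ones (suc k) D.*_) (prod-columnsOfOnes j)

  -- The share of the columns of ones alone. It is common to all members of the family and cancels
  -- when two values are compared.
  baseline : ℤ
  baseline = top k (proj₂ (ones (suc k) Dᵉ.^ N))

  -- The derivative of a product has two terms: differentiating the part L gives v, and
  -- differentiating the columns of ones gives `baseline`, because L has constant part 1.
  top-contribution : ∀ {L v} → Contributes L v →
    top (suc k) (prod (linear (suc k)) (columnsOfOnes ++ L)) ≡ v ℤ.+ baseline
  top-contribution {L} (u , p , q) = ≡.trans
    (top-cong (suc k) (D.trans (prod-++ (linear (suc k)) columnsOfOnes L)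
      (D.*-cong (D.reflexive (prod-columnsOfOnes N)) p)))
    (≡.trans (top-+ k _ _) (≡.cong₂ ℤ._+_
      (≡.trans (top-cong k (*-congʳ (reflexive (Dual.^-proj₁ (Alg k) (ones (suc k)) N)))) q)
      (top-cong k (*-identityʳ _))))

  -- Collects the terms - m of the digit contributions 2 e - m, up to sign. It does not depend on
  -- the digits.
  offset : ℕ → ℕ → ℕ → ℕ
  offset m s zero    = 0
  offset m s (suc d) = m ℕ.* weight k s N 1 ℕ.+ offset m (suc s) d

-- Numeration with rapidly decreasing weights.

module Digits (w : ℕ → ℕ) (m : ℕ) where

  evaluate : ∀ {d} → ℕ → Vec (Fin (suc m)) d → ℕ
  evaluate s []       = 0
  evaluate s (e ∷ es) = toℕ e ℕ.* w s ℕ.+ evaluate (suc s) es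

  module _ (k : ℕ) (w>0 : ∀ s → 0 < w s) (ratio : ∀ s → s < k → suc m ℕ.* w (suc s) ≤ w s) where

    -- By induction and `ratio` the later digits together stay below one unit `w s`, and the digit e
    -- itself contributes at most m such units.
    evaluate-< : ∀ {d} s (es : Vec (Fin (suc m)) d) → s ℕ.+ d ≤ k → evaluate s es < suc m ℕ.* w s
    evaluate-< s []       _ = ℕₚ.<-≤-trans (w>0 s) (ℕₚ.m≤m+n (w s) _)
    evaluate-< {suc d} s (e ∷ es) s+d≤k = begin-strict
      toℕ e ℕ.* w s ℕ.+ evaluate (suc s) es        <⟨ ℕₚ.+-monoʳ-< (toℕ e ℕ.* w s) (evaluate-< (suc s) es s+d≤k′) ⟩
      toℕ e ℕ.* w s ℕ.+ suc m ℕ.* w (suc s)        ≤⟨ ℕₚ.+-monoʳ-≤ (toℕ e ℕ.* w s) (ratio s (ℕₚ.≤-trans (s≤s (ℕₚ.m≤m+n s d)) s+d≤k′)) ⟩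
      toℕ e ℕ.* w s ℕ.+ w s                        ≡⟨ ℕₚ.+-comm (toℕ e ℕ.* w s) (w s) ⟩
      suc (toℕ e) ℕ.* w s                          ≤⟨ ℕₚ.*-monoˡ-≤ (w s) (Finₚ.toℕ<n e) ⟩
      suc m ℕ.* w s                                ∎
      where
      open ℕₚ.≤-Reasoning
      s+d≤k′ = ≡.subst (_≤ k) (ℕₚ.+-suc s d) s+d≤k

    digit-≤ : ∀ {a b x y v} → x < v → a ℕ.* v ℕ.+ y ≡ b ℕ.* v ℕ.+ x → a ≤ b
    digit-≤ {a} {b} {x} {y} {v} x<v eq = ℕₚ.≮⇒≥ λ b<a → ℕₚ.<-irrefl (≡.sym eq) (begin-strict
      b ℕ.* v ℕ.+ x   <⟨ ℕₚ.+-monoʳ-< (b ℕ.* v) x<v ⟩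
      b ℕ.* v ℕ.+ v   ≡⟨ ℕₚ.+-comm (b ℕ.* v) v ⟩
      suc b ℕ.* v     ≤⟨ ℕₚ.*-monoˡ-≤ v b<a ⟩
      a ℕ.* v         ≤⟨ ℕₚ.m≤m+n (a ℕ.* v) y ⟩
      a ℕ.* v ℕ.+ y   ∎)
      where open ℕₚ.≤-Reasoning

    evaluate-injective : ∀ {d} s (es fs : Vec (Fin (suc m)) d) → s ℕ.+ d ≤ k →
                         evaluate s es ≡ evaluate s fs → es ≡ fs
    evaluate-injective s []       []       _ _ = ≡.refl
    evaluate-injective {suc d} s (e ∷ es) (f ∷ fs) s+d≤k eq = ≡.cong₂ _∷_ (Finₚ.toℕ-injective e≡f)
      (evaluate-injective (suc s) es fs s+d≤k′
        (ℕₚ.+-cancelˡ-≡ (toℕ e ℕ.* w s) _ _ (≡.trans eq (≡.cong (λ x → x ℕ.* w s ℕ.+ evaluate (suc s) fs) (≡.sym e≡f)))))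
      where
      s+d≤k′ = ≡.subst (_≤ k) (ℕₚ.+-suc s d) s+d≤k
      small : ∀ gs → evaluate (suc s) gs < w s
      small gs = ℕₚ.<-≤-trans (evaluate-< (suc s) gs s+d≤k′) (ratio s (ℕₚ.≤-trans (s≤s (ℕₚ.m≤m+n s d)) s+d≤k′))
      e≡f = ℕₚ.≤-antisym (digit-≤ (small fs) eq) (digit-≤ (small es) (≡.sym eq))

-- The condition k ≤ N keeps the falling factorial from reaching 0.
weight->0 : ∀ k s N p → 0 < p → k ≤ N → 0 < weight k s N p
weight->0 zero    s       N       p p>0 k≤N = s≤s z≤n
weight->0 (suc k) zero    (suc N) p p>0 (s≤s k≤N) =
  ℕₚ.*-mono-≤ {1} {2} (s≤s z≤n) (ℕₚ.*-mono-≤ {1} {suc N} (s≤s z≤n) (weight->0 k zero N p p>0 k≤N))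
weight->0 (suc k) (suc s) N       p p>0 k<N =
  ℕₚ.*-mono-≤ (ℕₚ.*-mono-≤ {1} {2} (s≤s z≤n) p>0) (weight->0 k s N (suc p) (s≤s z≤n) (ℕₚ.<⇒≤ k<N))

-- Both sides are 2ᵏ N(N-1)⋯(N-k). Two different p are allowed because the rising factorial is empty
-- at s = 0, and `weight-ratio` compares weights at p and p + 1.
weight-falling : ∀ k N p p′ → N ℕ.* weight k zero (ℕ.pred N) p ≡ (N ℕ.∸ k) ℕ.* weight k zero N p′
weight-falling zero    N       p p′ = ≡.refl
weight-falling (suc k) zero    p p′ = ≡.refl
weight-falling (suc k) (suc N) p p′ = begin
  suc N ℕ.* (2 ℕ.* (N ℕ.* weight k zero (ℕ.pred N) p))
    ≡⟨ ≡.cong (λ x → suc N ℕ.* (2 ℕ.* x)) (weight-falling k N p p′) ⟩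
  suc N ℕ.* (2 ℕ.* ((N ℕ.∸ k) ℕ.* weight k zero N p′))
    ≡⟨ solve 3 (λ a b c → a :* (con 2 :* (b :* c)) := b :* (con 2 :* (a :* c))) ≡.refl (suc N) (N ℕ.∸ k) _ ⟩
  (N ℕ.∸ k) ℕ.* (2 ℕ.* (suc N ℕ.* weight k zero N p′)) ∎
  where
  open ≡.≡-Reasoning
  open SemiringSolver ℕₚ.+-*-commutativeSemiring using (solve; _:=_; _:*_; con)

-- Passing from s to s + 1 replaces the factor N-k+s+1 by p+s. The induction strips the first s
-- coordinates, whose factors the two weights share.
weight-ratio : ∀ k s N p b → s < k → k ℕ.+ b ℕ.* (p ℕ.+ s) ≤ N →
               b ℕ.* weight k (suc s) N p ≤ weight k s N p
weight-ratio (suc k) zero    N p b _ h = begin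
  b ℕ.* (2 ℕ.* p ℕ.* W)               ≡⟨ solve 3 (λ b p w → b :* (con 2 :* p :* w) := con 2 :* (b :* p :* w)) ≡.refl b p W ⟩
  2 ℕ.* (b ℕ.* p ℕ.* W)               ≤⟨ ℕₚ.*-monoʳ-≤ 2 (ℕₚ.*-monoˡ-≤ W bp≤N-k) ⟩
  2 ℕ.* ((N ℕ.∸ k) ℕ.* W)             ≡⟨ ≡.cong (2 ℕ.*_) (≡.sym (weight-falling k N p (suc p))) ⟩
  2 ℕ.* (N ℕ.* weight k zero (ℕ.pred N) p) ∎
  where
  open ℕₚ.≤-Reasoning
  open SemiringSolver ℕₚ.+-*-commutativeSemiring using (solve; _:=_; _:*_; con)
  W = weight k zero N (suc p)
  bp≤N-k : b ℕ.* p ≤ N ℕ.∸ k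
  bp≤N-k = ℕₚ.m+n≤o⇒m≤o∸n (b ℕ.* p) (begin
    b ℕ.* p ℕ.+ k               ≡⟨ ℕₚ.+-comm (b ℕ.* p) k ⟩
    k ℕ.+ b ℕ.* p               ≡⟨ ≡.cong (λ x → k ℕ.+ b ℕ.* x) (≡.sym (ℕₚ.+-identityʳ p)) ⟩
    k ℕ.+ b ℕ.* (p ℕ.+ 0)       ≤⟨ ℕₚ.n≤1+n _ ⟩
    suc k ℕ.+ b ℕ.* (p ℕ.+ 0)   ≤⟨ h ⟩
    N                           ∎)
weight-ratio (suc k) (suc s) N p b (s≤s s<k) h = begin
  b ℕ.* (2 ℕ.* p ℕ.* W)   ≡⟨ solve 3 (λ b p w → b :* (p :* w) := p :* (b :* w)) ≡.refl b (2 ℕ.* p) W ⟩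
  2 ℕ.* p ℕ.* (b ℕ.* W)   ≤⟨ ℕₚ.*-monoʳ-≤ (2 ℕ.* p) (weight-ratio k s N (suc p) b s<k
                               (ℕₚ.≤-trans (ℕₚ.≤-reflexive (≡.cong (λ x → k ℕ.+ b ℕ.* x) (≡.sym (ℕₚ.+-suc p s))))
                                 (ℕₚ.≤-trans (ℕₚ.n≤1+n _) h))) ⟩
  2 ℕ.* p ℕ.* weight k s N (suc p) ∎
  where
  open ℕₚ.≤-Reasoning
  open SemiringSolver ℕₚ.+-*-commutativeSemiring using (solve; _:=_; _:*_; con)
  W = weight k (suc s) N (suc p)

-- The family of matrices: contributions, sizes, signs and values.

module _ (k N m : ℕ) where
  open Digits (λ s → weight k s N 1) m

  contributes-digits : ∀ {d} s (es : Vec (Fin (suc m)) d) →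
    Contributes k N (digitColumns k m s es) (ℤ.+ 2 ℤ.* ℤ.+ evaluate s es ℤ.- ℤ.+ offset k N m s d)
  contributes-digits s []       = contributes-[] k N
  contributes-digits {suc d} s (e ∷ es) = ≡.subst (Contributes k N (digitColumns k m s (e ∷ es))) value
    (contributes-++ k N {blocks k (toℕ e) 1ℤ s} (contributes-blocks k N (toℕ e) 1ℤ s)
      (contributes-++ k N {blocks k (m ℕ.∸ toℕ e) -1ℤ s} (contributes-blocks k N (m ℕ.∸ toℕ e) -1ℤ s)
        (contributes-digits (suc s) es)))
    where
    w = weight k s N 1
    x = toℕ e
    y = m ℕ.∸ toℕ e
    x+y : m ≡ x ℕ.+ y
    x+y = ≡.sym (ℕₚ.m+[n∸m]≡n (ℕₚ.≤-pred (Finₚ.toℕ<n e)))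
    ring : ∀ x y w t o → x ℤ.* (1ℤ ℤ.* w) ℤ.+ (y ℤ.* (-1ℤ ℤ.* w) ℤ.+ (ℤ.+ 2 ℤ.* t ℤ.- o))
             ≡ ℤ.+ 2 ℤ.* (x ℤ.* w ℤ.+ t) ℤ.- ((x ℤ.+ y) ℤ.* w ℤ.+ o)
    ring = solve-∀
    +-cast : ∀ a b c → ℤ.+ a ℤ.* ℤ.+ b ℤ.+ ℤ.+ c ≡ ℤ.+ (a ℕ.* b ℕ.+ c)
    +-cast a b c = ≡.cong (λ z → z ℤ.+ ℤ.+ c) (≡.sym (ℤₚ.pos-* a b))
    value : ℤ.+ x ℤ.* (1ℤ ℤ.* ℤ.+ w) ℤ.+ (ℤ.+ y ℤ.* (-1ℤ ℤ.* ℤ.+ w)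
              ℤ.+ (ℤ.+ 2 ℤ.* ℤ.+ evaluate (suc s) es ℤ.- ℤ.+ offset k N m (suc s) d))
          ≡ ℤ.+ 2 ℤ.* ℤ.+ evaluate s (e ∷ es) ℤ.- ℤ.+ offset k N m s (suc d)
    value = ≡.trans (ring (ℤ.+ x) (ℤ.+ y) (ℤ.+ w) _ _) (≡.cong₂ (λ a b → ℤ.+ 2 ℤ.* a ℤ.- b)
      (+-cast x w (evaluate (suc s) es))
      (≡.trans (+-cast (x ℕ.+ y) w (offset k N m (suc s) d)) (≡.cong (λ z → ℤ.+ (z ℕ.* w ℕ.+ offset k N m (suc s) d)) (≡.sym x+y))))

length-cube : ∀ k → length (cube k) ≡ 2 ℕ.^ k
length-cube zero    = ≡.refl
length-cube (suc k) = ≡.trans (Listₚ.length-++ (map (1ℤ ∷_) (cube k)))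
  (≡.cong₂ ℕ._+_ (≡.trans (Listₚ.length-map _ (cube k)) (length-cube k))
    (≡.trans (Listₚ.length-map _ (cube k)) (≡.trans (length-cube k) (≡.sym (ℕₚ.+-identityʳ _)))))

module _ (k : ℕ) where

  length-blocks : ∀ j c s → length (blocks k j c s) ≡ j ℕ.* 2 ℕ.^ k
  length-blocks zero    c s = ≡.refl
  length-blocks (suc j) c s = ≡.trans (Listₚ.length-++ (block k c s))
    (≡.cong₂ ℕ._+_ (≡.trans (Listₚ.length-map _ (cube k)) (length-cube k)) (length-blocks j c s))

  -- This is why a digit e is completed by m - e negative blocks: the number of columns, and with it
  -- n, has to be the same for all digit vectors.
  length-digitColumns : ∀ m {d} s (es : Vec (Fin (suc m)) d) →
                        length (digitColumns k m s es) ≡ d ℕ.* (m ℕ.* 2 ℕ.^ k)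
  length-digitColumns m s []       = ≡.refl
  length-digitColumns m {suc d} s (e ∷ es) = begin
    length (blocks k x 1ℤ s ++ (blocks k y -1ℤ s ++ rest))
      ≡⟨ Listₚ.length-++ (blocks k x 1ℤ s) ⟩
    length (blocks k x 1ℤ s) ℕ.+ length (blocks k y -1ℤ s ++ rest)
      ≡⟨ ≡.cong (length (blocks k x 1ℤ s) ℕ.+_) (Listₚ.length-++ (blocks k y -1ℤ s)) ⟩
    length (blocks k x 1ℤ s) ℕ.+ (length (blocks k y -1ℤ s) ℕ.+ length rest)
      ≡⟨ ≡.cong₂ ℕ._+_ (length-blocks x 1ℤ s) (≡.cong₂ ℕ._+_ (length-blocks y -1ℤ s) (length-digitColumns m (suc s) es)) ⟩
    x ℕ.* 2 ℕ.^ k ℕ.+ (y ℕ.* 2 ℕ.^ k ℕ.+ d ℕ.* (m ℕ.* 2 ℕ.^ k))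
      ≡⟨ ≡.sym (ℕₚ.+-assoc (x ℕ.* 2 ℕ.^ k) _ _) ⟩
    (x ℕ.* 2 ℕ.^ k ℕ.+ y ℕ.* 2 ℕ.^ k) ℕ.+ d ℕ.* (m ℕ.* 2 ℕ.^ k)
      ≡⟨ ≡.cong (ℕ._+ d ℕ.* (m ℕ.* 2 ℕ.^ k)) (≡.trans (≡.sym (ℕₚ.*-distribʳ-+ (2 ℕ.^ k) x y))
           (≡.cong (ℕ._* 2 ℕ.^ k) (ℕₚ.m+[n∸m]≡n (ℕₚ.≤-pred (Finₚ.toℕ<n e))))) ⟩
    suc d ℕ.* (m ℕ.* 2 ℕ.^ k) ∎
    where
    open ≡.≡-Reasoning
    x = toℕ e
    y = m ℕ.∸ toℕ e
    rest = digitColumns k m (suc s) es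

Signed : ∀ {n} → Vec ℤ n → Set
Signed = VAll.All (_∈ signs)

sign-* : ∀ {a b} → a ∈ signs → b ∈ signs → a ℤ.* b ∈ signs
sign-* (here ≡.refl)         (here ≡.refl)         = here ≡.refl
sign-* (here ≡.refl)         (there (here ≡.refl)) = there (here ≡.refl)
sign-* (there (here ≡.refl)) (here ≡.refl)         = there (here ≡.refl)
sign-* (there (here ≡.refl)) (there (here ≡.refl)) = here ≡.refl

sign-neg : ∀ {a} → a ∈ signs → ℤ.- a ∈ signs
sign-neg (here ≡.refl)         = there (here ≡.refl)
sign-neg (there (here ≡.refl)) = here ≡.refl

signed-χ : ∀ {k} s {c : Vec ℤ k} → Signed c → χ s c ∈ signs
signed-χ zero    _              = here ≡.refl
signed-χ (suc s) VAll.[]        = here ≡.refl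
signed-χ (suc s) (ε VAll.∷ ε∈) = sign-* (sign-neg ε) (signed-χ s ε∈)

signed-cube : ∀ k → All Signed (cube k)
signed-cube zero    = VAll.[] ∷ []
signed-cube (suc k) = Allₚ.++⁺ (Allₚ.map⁺ (All.map (here ≡.refl VAll.∷_) (signed-cube k)))
                               (Allₚ.map⁺ (All.map (there (here ≡.refl) VAll.∷_) (signed-cube k)))

module _ (k : ℕ) where

  signed-blocks : ∀ j {c} s → c ∈ signs → All Signed (blocks k j c s)
  signed-blocks zero    s c∈ = []
  signed-blocks (suc j) s c∈ = Allₚ.++⁺
    (Allₚ.map⁺ (All.map (λ y∈ → sign-* c∈ (signed-χ s y∈) VAll.∷ y∈) (signed-cube k)))
    (signed-blocks j s c∈)

  signed-digitColumns : ∀ m {d} s (es : Vec (Fin (suc m)) d) → All Signed (digitColumns k m s es)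
  signed-digitColumns m s []       = []
  signed-digitColumns m s (e ∷ es) = Allₚ.++⁺ (signed-blocks (toℕ e) s (here ≡.refl))
    (Allₚ.++⁺ (signed-blocks (m ℕ.∸ toℕ e) s (there (here ≡.refl))) (signed-digitColumns m (suc s) es))

-- `n≡` counts columns: N columns of ones and m cubes for each of the k digits. `n≡′` counts rows:
-- the character row, the k cube rows and q rows of ones.
module Family (k m q n : ℕ) (N : ℕ) (n≡ : n ≡ N ℕ.+ k ℕ.* (m ℕ.* 2 ℕ.^ k)) (n≡′ : n ≡ suc k ℕ.+ q) where
  open Digits (λ s → weight k s N 1) m

  value : Vec (Fin (suc m)) k → ℤ
  value es = ℤ.+ (q !) ℤ.* (ℤ.+ 2 ℤ.* ℤ.+ evaluate 0 es ℤ.- ℤ.+ offset k N m 0 k ℤ.+ baseline k N)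

  value-attained : ∀ es → value es ∈ map per (Ω n)
  value-attained es = ≡.subst (_∈ map per (Ω n))
    (≡.cong (ℤ.+ (q !) ℤ.*_) (≡.trans
      (≡.cong (λ L → top (suc k) (FiniteSums.prod (Alg (suc k)) (linear (suc k)) L)) (≡.trans (Vecₚ.toList-cast (≡.sym n≡len) (fromList cs)) (Vecₚ.toList∘fromList cs)))
      (top-contribution k N (contributes-digits k N m 0 es))))
    (permanent-attained q (Vec.cast (≡.sym n≡len) (fromList cs)) n≡′ signed)
    where
    cs = columnsOfOnes k N ++ digitColumns k m 0 es
    n≡len : n ≡ length cs
    n≡len = ≡.trans n≡ (≡.sym (≡.trans (Listₚ.length-++ (columnsOfOnes k N))
      (≡.cong₂ ℕ._+_ (Listₚ.length-replicate N) (length-digitColumns k m 0 es))))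
    cast⁺ : ∀ {a b} {P : Vec ℤ (suc k) → Set} {xs : Vec (Vec ℤ (suc k)) a} (eq : a ≡ b) → VAll.All P xs → VAll.All P (Vec.cast eq xs)
    cast⁺ {P = P} {xs} ≡.refl ps = ≡.subst (VAll.All P) (≡.sym (Vecₚ.cast-is-id ≡.refl xs)) ps
    signed : VAll.All Signed (Vec.cast (≡.sym n≡len) (fromList cs))
    signed = cast⁺ (≡.sym n≡len) (VAllₚ.fromList⁺ (Allₚ.++⁺
      (Allₚ.replicate⁺ N (replicate⁺ (suc k) (here ≡.refl)))
      (signed-digitColumns k m 0 es)))

  module _ (large : k ℕ.+ suc m ℕ.* suc k ≤ N) where

    -- The nonzero factor q! and the common terms `baseline` and `offset` cancel, which leaves
    -- `evaluate`. The bound `large` yields the condition of `weight-ratio` with b = m + 1 and p = 1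
    -- for all s < k.
    value-injective : ∀ es fs → value es ≡ value fs → es ≡ fs
    value-injective es fs eq = evaluate-injective k
      (λ s → weight->0 k s N 1 (s≤s z≤n) (ℕₚ.m+n≤o⇒m≤o k large))
      (λ s s<k → weight-ratio k s N 1 (suc m) s<k
        (ℕₚ.≤-trans (ℕₚ.+-monoʳ-≤ k (ℕₚ.*-monoʳ-≤ (suc m) (s≤s (ℕₚ.<⇒≤ s<k)))) large))
      0 es fs ℕₚ.≤-refl
      (ℤₚ.+-injective (ℤₚ.*-cancelˡ-≡ (ℤ.+ 2) _ _
        (ℤ-Group.∙-cancelʳ _ _ _ (ℤ-Group.∙-cancelʳ (baseline k N) _ _ (ℤₚ.*-cancelˡ-≡ (ℤ.+ (q !)) _ _ {{q!≢0}} eq)))))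
      where q!≢0 = q ℕₚ.!≢0

-- Counting the distinct permanents.

digits : ∀ b d → Fin (b ℕ.^ d) → Vec (Fin b) d
digits b zero    i = []
digits b (suc d) i = Fin.quotient {b} (b ℕ.^ d) i ∷ digits b d (Fin.remainder {b} (b ℕ.^ d) i)

digits-injective : ∀ b d i j → digits b d i ≡ digits b d j → i ≡ j
digits-injective b zero    Fin.zero Fin.zero _ = ≡.refl
digits-injective b (suc d) i j eq = begin
  i ≡⟨ ≡.sym (Finₚ.combine-remQuot {b} (b ℕ.^ d) i) ⟩
  Fin.combine (Fin.quotient {b} (b ℕ.^ d) i) (Fin.remainder {b} (b ℕ.^ d) i)
    ≡⟨ ≡.cong₂ Fin.combine (Vecₚ.∷-injectiveˡ eq) (digits-injective b d _ _ (Vecₚ.∷-injectiveʳ eq)) ⟩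
  Fin.combine (Fin.quotient {b} (b ℕ.^ d) j) (Fin.remainder {b} (b ℕ.^ d) j)
    ≡⟨ Finₚ.combine-remQuot {b} (b ℕ.^ d) j ⟩
  j ∎
  where open ≡.≡-Reasoning

-- Sending i to the position of f i in the deduplicated list is an injection into `Fin (r n)`.
r-≥ : ∀ n K (f : Fin K → ℤ) → (∀ i j → f i ≡ f j → i ≡ j) → (∀ i → f i ∈ map per (Ω n)) → K ≤ r n
r-≥ n K f inj f∈ = Finₚ.injective⇒≤ {f = λ i → Any.index (f∈′ i)}
  λ {i} {j} eq → inj i j (≡.trans (Anyₚ.lookup-index (f∈′ i))
    (≡.trans (≡.cong (List.lookup (deduplicate ℤ._≟_ (map per (Ω n)))) eq) (≡.sym (Anyₚ.lookup-index (f∈′ j)))))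
  where
  f∈′ : ∀ i → f i ∈ deduplicate ℤ._≟_ (map per (Ω n))
  f∈′ i = ∈ₚ.∈-deduplicate⁺ ℤ._≟_ (f∈ i)

n<2^n : ∀ n → n < 2 ℕ.^ n
n<2^n zero    = s≤s z≤n
n<2^n (suc n) = ℕₚ.+-mono-≤-< (ℕₚ.≤-trans (s≤s z≤n) (n<2^n n)) (ℕₚ.<-≤-trans (n<2^n n) (ℕₚ.m≤m+n _ 0))

-- With k digits in base m + 1 = 2ᵏ = B there are Bᵏ values. The digits occupy k (B - 1) B columns
-- and `large` asks for k + B (k + 1) columns of ones; together these are B + k + k B², at most (k +
-- 1) B² ≤ B³.
r-lower-bound : ∀ n k → 1 ≤ k → (2 ℕ.^ k) ℕ.* (2 ℕ.^ k) ℕ.* (2 ℕ.^ k) ≤ n → 2 ℕ.^ (k ℕ.* k) ≤ r n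
r-lower-bound n k 1≤k B³≤n = ≡.subst (_≤ r n) (≡.trans (≡.cong (ℕ._^ k) B≡) (ℕₚ.^-*-assoc 2 k k))
  (r-≥ n (suc m ℕ.^ k) (value ∘ digits (suc m) k)
    (λ i j eq → digits-injective (suc m) k i j (value-injective large _ _ eq))
    (λ i → value-attained (digits (suc m) k i)))
  where
  B m N : ℕ
  B = 2 ℕ.^ k
  m = ℕ.pred B
  -- All columns that the digits leave over are columns of ones.
  N = n ℕ.∸ k ℕ.* (m ℕ.* B)
  B≡ : suc m ≡ B
  B≡ = ℕₚ.suc-pred B {{ℕₚ.m^n≢0 2 k}}
  k<B : suc k ≤ B
  k<B = n<2^n k
  open ℕₚ.≤-Reasoning
  open SemiringSolver ℕₚ.+-*-commutativeSemiring using (solve; _:=_; _:*_; _:+_; con)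
  enough : k ℕ.+ suc m ℕ.* suc k ℕ.+ k ℕ.* (m ℕ.* B) ≤ n
  enough = begin
    k ℕ.+ suc m ℕ.* suc k ℕ.+ k ℕ.* (m ℕ.* B)
      ≡⟨ ≡.cong (λ b → k ℕ.+ suc m ℕ.* suc k ℕ.+ k ℕ.* (m ℕ.* b)) (≡.sym B≡) ⟩
    k ℕ.+ suc m ℕ.* suc k ℕ.+ k ℕ.* (m ℕ.* suc m)
      ≡⟨ solve 2 (λ k m → k :+ (con 1 :+ m) :* (con 1 :+ k) :+ k :* (m :* (con 1 :+ m))
                       := (con 1 :+ m) :+ k :+ k :* ((con 1 :+ m) :* (con 1 :+ m))) ≡.refl k m ⟩
    suc m ℕ.+ k ℕ.+ k ℕ.* (suc m ℕ.* suc m)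
      ≡⟨ ≡.cong (λ b → b ℕ.+ k ℕ.+ k ℕ.* (b ℕ.* b)) B≡ ⟩
    B ℕ.+ k ℕ.+ k ℕ.* (B ℕ.* B)
      ≤⟨ ℕₚ.+-monoˡ-≤ (k ℕ.* (B ℕ.* B)) (begin
        B ℕ.+ k     ≤⟨ ℕₚ.+-monoʳ-≤ B (ℕₚ.<⇒≤ k<B) ⟩
        B ℕ.+ B     ≡⟨ ≡.cong (B ℕ.+_) (≡.sym (ℕₚ.+-identityʳ B)) ⟩
        2 ℕ.* B     ≤⟨ ℕₚ.*-monoˡ-≤ B (ℕₚ.≤-trans (s≤s 1≤k) k<B) ⟩
        B ℕ.* B     ∎) ⟩
    suc k ℕ.* (B ℕ.* B)
      ≤⟨ ℕₚ.*-monoˡ-≤ (B ℕ.* B) k<B ⟩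
    B ℕ.* (B ℕ.* B)
      ≡⟨ ≡.sym (ℕₚ.*-assoc B B B) ⟩
    B ℕ.* B ℕ.* B
      ≤⟨ B³≤n ⟩
    n ∎
  large : k ℕ.+ suc m ℕ.* suc k ≤ N
  large = ℕₚ.m+n≤o⇒m≤o∸n _ enough
  k<n : suc k ≤ n
  k<n = begin
    suc k                       ≤⟨ ℕₚ.m≤m+n (suc k) (m ℕ.* suc k) ⟩
    suc m ℕ.* suc k             ≤⟨ ℕₚ.m≤n+m _ k ⟩
    k ℕ.+ suc m ℕ.* suc k       ≤⟨ large ⟩
    N                           ≤⟨ ℕₚ.m∸n≤m n (k ℕ.* (m ℕ.* B)) ⟩
    n                           ∎
  open Family k m (n ℕ.∸ suc k) n N
    (≡.sym (ℕₚ.m∸n+n≡m (ℕₚ.≤-trans (ℕₚ.m≤n+m (k ℕ.* (m ℕ.* B)) (k ℕ.+ suc m ℕ.* suc k)) enough))) (≡.sym (ℕₚ.m+[n∸m]≡n k<n))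

-- Logarithms and the final estimate.

2^⌊log₂n⌋≤n : ∀ n → 1 ≤ n → 2 ℕ.^ ⌊log₂ n ⌋ ≤ n
2^⌊log₂n⌋≤n = <-rec _ step
  where
  open ℕₚ.≤-Reasoning
  step : ∀ n → (∀ {h} → h < n → 1 ≤ h → 2 ℕ.^ ⌊log₂ h ⌋ ≤ h) → 1 ≤ n → 2 ℕ.^ ⌊log₂ n ⌋ ≤ n
  step (suc zero)    _  _ = s≤s z≤n
  step n@(suc (suc n′)) ih _ = begin
    -- For n ≥ 2 the logarithm is at least 1, so the truncated subtraction loses nothing; halving n
    -- then lowers the exponent by one.
    2 ℕ.^ ⌊log₂ n ⌋                ≡⟨ ≡.cong (2 ℕ.^_) (≡.sym (ℕₚ.m+[n∸m]≡n {1} (⌊log₂⌋-mono-≤ {2} {n} (s≤s (s≤s z≤n))))) ⟩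
    2 ℕ.* 2 ℕ.^ (⌊log₂ n ⌋ ℕ.∸ 1)  ≡⟨ ≡.cong (λ l → 2 ℕ.* 2 ℕ.^ l) (≡.sym (⌊log₂⌊n/2⌋⌋≡⌊log₂n⌋∸1 n)) ⟩
    2 ℕ.* 2 ℕ.^ ⌊log₂ h ⌋          ≤⟨ ℕₚ.*-monoʳ-≤ 2 (ih (ℕₚ.⌊n/2⌋<n (suc n′)) (s≤s z≤n)) ⟩
    2 ℕ.* h                        ≡⟨ ≡.cong (h ℕ.+_) (ℕₚ.+-identityʳ h) ⟩
    h ℕ.+ h                        ≤⟨ ℕₚ.+-monoʳ-≤ h (ℕₚ.⌊n/2⌋≤⌈n/2⌉ n) ⟩
    h ℕ.+ ℕ.⌈ n /2⌉                ≡⟨ ℕₚ.⌊n/2⌋+⌈n/2⌉≡n n ⟩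
    n                              ∎
    where h = ℕ.⌊ n /2⌋

open import Data.Nat using (_*_; _^_; _≥_; _>_)

theorem2 : Σ ℕ λ a → Σ ℕ λ b → (a > 0) × (b > 0) × (Σ ℕ λ N → (n : ℕ) → n ≥ N →
    a * (⌊log₂ n ⌋ ^ 2) ≤ b * (⌊log₂ (r n) ⌋ * ⌊log₂ ⌊log₂ n ⌋ ⌋))
-- 64 is the square of the 8 in `l≤8k`, and n ≥ 16 = 2⁴ makes l ≥ 4 and hence k ≥ 1.
theorem2 = 1 , 64 , s≤s z≤n , s≤s z≤n , 16 , bound
  where
  open ℕₚ.≤-Reasoning
  open SemiringSolver ℕₚ.+-*-commutativeSemiring using (solve; _:=_; _:*_; _:+_; con)
  bound : ∀ n → 16 ≤ n → 1 * (⌊log₂ n ⌋ ^ 2) ≤ 64 * (⌊log₂ (r n) ⌋ * ⌊log₂ ⌊log₂ n ⌋ ⌋)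
  bound n 16≤n = begin
    1 * l ^ 2                        ≡⟨ solve 1 (λ l → con 1 :* (l :* (l :* con 1)) := l :* l) ≡.refl l ⟩
    l * l                              ≤⟨ ℕₚ.*-mono-≤ l≤8k l≤8k ⟩
    8 * k * (8 * k)                ≡⟨ solve 1 (λ k → con 8 :* k :* (con 8 :* k) := con 64 :* (k :* k :* con 1)) ≡.refl k ⟩
    -- The factor 1 stands for ⌊log₂ 2⌋, which is at most ⌊log₂ l⌋ because l ≥ 4.
    64 * (k * k * 1)               ≤⟨ ℕₚ.*-monoʳ-≤ 64 (ℕₚ.*-mono-≤ k²≤log-r (⌊log₂⌋-mono-≤ {2} {l} (ℕₚ.≤-trans (s≤s (s≤s z≤n)) 4≤l))) ⟩
    64 * (⌊log₂ (r n) ⌋ * ⌊log₂ l ⌋) ∎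
    where
    l k B : ℕ
    l = ⌊log₂ n ⌋
    -- A quarter of the logarithm suffices for B³ = 2^(3k) ≤ 2^(4k) ≤ 2ˡ ≤ n.
    k = l ℕ./ 4
    B = 2 ^ k
    4≤l : 4 ≤ l
    4≤l = ⌊log₂⌋-mono-≤ 16≤n
    l<4+4k : l < 4 ℕ.+ k * 4
    l<4+4k = ℕₚ.≤-<-trans (ℕₚ.≤-reflexive (m≡m%n+[m/n]*n l 4)) (ℕₚ.+-monoˡ-< (k * 4) (m%n<n l 4))
    1≤k : 1 ≤ k
    1≤k = ℕₚ.n≢0⇒n>0 λ k≡0 → ℕₚ.<⇒≱ (≡.subst (λ x → l < 4 ℕ.+ x * 4) k≡0 l<4+4k) 4≤l
    l≤8k : l ≤ 8 * k
    l≤8k = begin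
      l                     ≤⟨ ℕₚ.<⇒≤ l<4+4k ⟩
      4 ℕ.+ k * 4         ≤⟨ ℕₚ.+-monoˡ-≤ (k * 4) (ℕₚ.*-monoˡ-≤ 4 1≤k) ⟩
      k * 4 ℕ.+ k * 4   ≡⟨ solve 1 (λ k → k :* con 4 :+ k :* con 4 := con 8 :* k) ≡.refl k ⟩
      8 * k               ∎
    B³≤n : B * B * B ≤ n
    B³≤n = begin
      B * B * B           ≡⟨ ≡.cong (ℕ._* B) (≡.sym (ℕₚ.^-distribˡ-+-* 2 k k)) ⟩
      2 ^ (k ℕ.+ k) * B   ≡⟨ ≡.sym (ℕₚ.^-distribˡ-+-* 2 (k ℕ.+ k) k) ⟩
      2 ^ (k ℕ.+ k ℕ.+ k)   ≤⟨ ℕₚ.^-monoʳ-≤ 2 (begin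
        k ℕ.+ k ℕ.+ k         ≤⟨ ℕₚ.m≤m+n _ k ⟩
        k ℕ.+ k ℕ.+ k ℕ.+ k   ≡⟨ solve 1 (λ k → k :+ k :+ k :+ k := k :* con 4) ≡.refl k ⟩
        k * 4               ≤⟨ m/n*n≤m l 4 ⟩
        l                     ∎) ⟩
      2 ^ l                 ≤⟨ 2^⌊log₂n⌋≤n n (ℕₚ.≤-trans (s≤s z≤n) 16≤n) ⟩
      n                       ∎
    k²≤log-r : k * k ≤ ⌊log₂ (r n) ⌋
    k²≤log-r = ≡.subst (_≤ ⌊log₂ (r n) ⌋) (⌊log₂[2^n]⌋≡n (k * k)) (⌊log₂⌋-mono-≤ (r-lower-bound n k 1≤k B³≤n))
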